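{- For all $k\in\mathbb{N}$, all $\varepsilon\in(0,1)$, all primes $p$, all $n,r\in\mathbb{N}$, and all functions $f:\mathbb{F}_p^n\to\mathbb{F}_p^r$ that are $\varepsilon$-far from being a group homomorphism, \[\Pr[\mathsf{RandomCoefficientsTest}_{2k}\text{ rejects } f]\ \ge\ \min\Big\{\frac{(2k-3)\varepsilon}{3},\ \frac1{16}\Big\}.\]
   Context: $\mathsf{RandomCoefficientsTest}_m$: draw $x_1,\dots,x_m\in\mathbb{F}_p^n$ independently and uniformly, and coefficients $\sigma_1,\dots,\sigma_m$ independently and uniformly from $\{1,\dots,p-1\}\subseteq\mathbb{F}_p$; let $a=\sum_{i\in[m]}\sigma_i x_i$ (scalar multiplication in $\mathbb{F}_p$); query $f(x_1),\dots,f(x_m),f(a)$; accept iff $\sum_{i\in[m]}\sigma_i f(x_i)=f(a)$, otherwise reject. $f$ is $\varepsilon$-far from being a homomorphism if $\Pr_x[f(x)\ne h(x)]>\varepsilon$ for every additive group homomorphism $h:\mathbb{F}_p^n\to\mathbb{F}_p^r$.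
   Formalization: The parameter ε ranges over the rational numbers in (0,1) rather than the real ones; the real case follows by density, since being ε-far is monotone in ε and the bound is continuous in ε. -}

module Defs where

open import Data.Nat using (ℕ; zero; suc; _+_; _*_)
open import Data.Nat.DivMod using (_mod_)
open import Data.Fin using (Fin; toℕ) renaming (zero to fzero)
open import Data.Fin.Properties using () renaming (_≟_ to _≟F_)
open import Data.Vec using (Vec; []; _∷_; zipWith; replicate; map)
open import Data.Vec.Properties using (≡-dec)
open import Data.List using (List; []; _∷_; concatMap; length; filter; cartesianProduct)
open import Data.List.Base using (allFin) renaming (map to lmap)
open import Data.Product using (_×_; _,_)
open import Data.Integer using (+_)
open import Data.Rational using (ℚ; 0ℚ; _/_)
open import Relation.Binary.PropositionalEquality using (_≡_; _≢_)
open import Relation.Nullary using (¬?)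

𝔽 : ℕ → Set
𝔽 p = Fin p

addF : ∀ {p} → 𝔽 p → 𝔽 p → 𝔽 p
addF {suc q} a b = (toℕ a + toℕ b) mod suc q

mulF : ∀ {p} → 𝔽 p → 𝔽 p → 𝔽 p
mulF {suc q} a b = (toℕ a * toℕ b) mod suc q

𝔽^ : ℕ → ℕ → Set
𝔽^ p n = Vec (𝔽 p) n

_⊕_ : ∀ {p n} → 𝔽^ p n → 𝔽^ p n → 𝔽^ p n
_⊕_ = zipWith addF

_⊙_ : ∀ {p n} → 𝔽 p → 𝔽^ p n → 𝔽^ p n
c ⊙ v = map (mulF c) v

𝟘 : ∀ {p n} → 𝔽 p → 𝔽^ p n
𝟘 z = replicate _ z

IsHom : ∀ {p n r} → (𝔽^ p n → 𝔽^ p r) → Set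
IsHom {p} {n} h = ∀ (x y : 𝔽^ p n) → h (x ⊕ y) ≡ h x ⊕ h y

vecsOf : ∀ {A : Set} → List A → (m : ℕ) → List (Vec A m)
vecsOf xs zero = [] ∷ []
vecsOf xs (suc m) = concatMap (λ a → lmap (a ∷_) (vecsOf xs m)) xs

allPoints : (p n : ℕ) → List (𝔽^ p n)
allPoints p n = vecsOf (allFin p) n

nonzero : (p : ℕ) → List (𝔽 p)
nonzero zero = []
nonzero (suc q) = filter (λ c → ¬? (c ≟F fzero)) (allFin (suc q))

-- a / b as a rational (0 if b = 0; never used with b = 0 here)
frac : ℕ → ℕ → ℚ
frac a zero = 0ℚ
frac a (suc b) = (+ a) / suc b

dist : ∀ {p n r} → (f h : 𝔽^ p n → 𝔽^ p r) → ℚ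
dist {p} {n} f h =
  frac (length (filter (λ x → ¬? (≡-dec _≟F_ (f x) (h x))) (allPoints p n)))
       (length (allPoints p n))

Far : ∀ {p n r} → ℚ → (𝔽^ p n → 𝔽^ p r) → Set
Far {p} {n} {r} ε f = ∀ (h : 𝔽^ p n → 𝔽^ p r) → IsHom h → ε Data.Rational.< dist f h

vsum : ∀ {p k} → 𝔽 p → ∀ {m} → Vec (𝔽^ p k) m → 𝔽^ p k
vsum z [] = 𝟘 z
vsum z (v ∷ vs) = v ⊕ vsum z vs

Rejects : ∀ {p n r m} → (𝔽^ p n → 𝔽^ p r) → Vec (𝔽^ p n) m → Vec (𝔽 p) m → Set
Rejects {zero} f xs σs = ⊥' where open import Data.Empty renaming (⊥ to ⊥')
Rejects {suc q} {n} {r} f xs σs =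
  vsum fzero (zipWith (λ s x → s ⊙ f x) σs xs) ≢ f (vsum fzero (zipWith _⊙_ σs xs))

rejects? : ∀ {p n r m} → (f : 𝔽^ p n → 𝔽^ p r) → (xs : Vec (𝔽^ p n) m) → (σs : Vec (𝔽 p) m)
         → Relation.Nullary.Dec (Rejects f xs σs)
rejects? {zero} f xs σs = Relation.Nullary.no (λ ())
rejects? {suc q} {n} {r} f xs σs =
  ¬? (≡-dec _≟F_ (vsum fzero (zipWith (λ s x → s ⊙ f x) σs xs)) (f (vsum fzero (zipWith _⊙_ σs xs))))

samples : (p n m : ℕ) → List (Vec (𝔽^ p n) m × Vec (𝔽 p) m)
samples p n m = cartesianProduct (vecsOf (allPoints p n) m) (vecsOf (nonzero p) m)

rejProb : ∀ {p n r} → ℕ → (𝔽^ p n → 𝔽^ p r) → ℚ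
rejProb {p} {n} {r} m f =
  frac (length (filter (λ s → rejects? f (Data.Product.proj₁ s) (Data.Product.proj₂ s)) (samples p n m)))
       (length (samples p n m))

{-# OPTIONS --safe #-}
module Submission where

-- Let R/T be the rejection probability for m = 2k, and suppose R/T < 1/16.
-- Fixing all but two of the sample points, together with the coefficients, shows
-- f(w) = σ₁ f(x) + K(w − σ₁x) for most (x, w).  Comparing (x, w) with
-- (x + u, w + σ₁u) cancels K, so for every u the difference f(x + u) − f(x) is the
-- same value φ(u) for more than 7/8 of all x.  Hence φ is a homomorphism and f
-- agrees with φ + b on more than 7/8 of the points for some constant b.
--
-- Put g = f − φ, and let G be the weighted sum of m − 1 samples of g.  Resampling
-- the remaining point, the test rejects with probability at least 3/4 as soon as
-- σ₁b + G ≠ b.  If b ≠ 0, this has probability at least 1/2: for p > 2 at most one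
-- σ₁ is bad, and for p = 2 a coordinate of G is a sum of the odd number m − 1 of
-- biased bits.  So b = 0, and then Pr[G ≠ 0] ≥ tη/(1 + 2tη) with t = m − 1 and
-- η = Pr[g ≠ 0], which gives R/T ≥ tη/3.

open import Defs
open import Algebra.Bundles using (AbelianGroup)
open import Data.Bool using (if_then_else_)
open import Data.Fin using (Fin; toℕ) renaming (zero to fzero; suc to fsuc)
open import Data.Fin.Properties using (toℕ-injective; toℕ-fromℕ<; toℕ<n) renaming (_≟_ to _≟F_)
open import Data.List using
    (List; []; _∷_; length; map; filter; concatMap; cartesianProduct; cartesianProductWith; _++_; allFin)
open import Data.List.Properties using (map-++; map-∘)
open import Data.List.Membership.Propositional using (_∈_)
open import Data.List.Membership.Propositional.Properties using
    (∈-allFin; ∈-map⁺; ∈-cartesianProductWith⁺; ∈-filter⁻; ∈-length)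
open import Data.List.Membership.Propositional.Properties.WithK using (unique∧set⇒bag)
open import Data.List.Relation.Binary.BagAndSetEquality using (∼bag⇒↭)
open import Data.List.Relation.Binary.Permutation.Propositional using (_↭_)
open import Data.List.Relation.Binary.Permutation.Propositional.Properties using (map⁺)
open import Data.List.Relation.Unary.All as All using (All)
open import Data.List.Relation.Unary.AllPairs using ([]; _∷_)
open import Data.List.Relation.Unary.Any using (here; there)
open import Data.List.Relation.Unary.Unique.Propositional using (Unique)
import Data.List.Relation.Unary.Unique.Propositional.Properties as Unique
open import Data.Nat using (ℕ; zero; suc; _*_)
open import Data.Nat.Primality using (Prime; ¬prime[0]; ¬prime[1])
open import Data.Nat.Tactic.RingSolver using (solve-∀)
open import Data.Product using (_×_; _,_; proj₁; proj₂; ∃; Σ)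
open import Data.Vec as Vec using (Vec; []; _∷_; zipWith; lookup)
open import Data.Vec.Properties as Vec using
    (∷-injective; ≡-dec; zipWith-assoc; zipWith-comm; zipWith-identityˡ; zipWith-identityʳ; zipWith-inverseˡ
    ; zipWith-inverseʳ; lookup-zipWith; lookup-replicate; map-cong; map-id)
open import Function using (_∘_; id)
open import Function.Bundles using (mk⇔)
open import Level using (0ℓ)
open import Relation.Binary.PropositionalEquality hiding ([_])
open import Relation.Nullary
open import Relation.Unary using (Decidable)

-- Indicators, finite sums over lists and averaging.

module Counting where

  open import Data.Nat
  open import Data.Nat.Properties
  open import Data.Nat.Coprimality using (prime⇒coprime; coprime-Bézout)
  open import Data.Nat.DivMod using (_%_; _mod_; m<n⇒m%n≡m; %-distribˡ-+; %-distribˡ-*; m*n%n≡0; [m+kn]%n≡m%n; m%n<n)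
  open import Data.Nat.GCD using (module Bézout)
  open import Data.Nat.ListAction using (sum)
  open import Data.Nat.ListAction.Properties using (sum-++; sum-↭)

  private variable
    A A′ : Set
    X Y Z : Set

  ind : Dec X → ℕ
  ind d = if does d then 1 else 0

  ind-yes : (d : Dec X) → X → ind d ≡ 1
  ind-yes (yes _) p = refl
  ind-yes (no ¬p) p = contradiction p ¬p

  ind-no : (d : Dec X) → ¬ X → ind d ≡ 0
  ind-no (yes p) ¬p = contradiction p ¬p
  ind-no (no _) _ = refl

  ind-mono : (d : Dec X) (e : Dec Y) → (X → Y) → ind d ≤ ind e
  ind-mono (no _) e f = z≤n
  ind-mono (yes p) (yes _) f = ≤-refl
  ind-mono (yes p) (no ¬q) f = contradiction (f p) ¬q

  -- Pointwise union bound. The implication is contraposed because the events in question are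
  -- failures: if neither of two equations fails, a third one derived from them does not fail
  -- either.
  ind-∪ : (d : Dec X) (e : Dec Y) (e′ : Dec Z) → (¬ Y → ¬ Z → ¬ X) → ind d ≤ ind e + ind e′
  ind-∪ (no _) e e′ f = z≤n
  ind-∪ (yes p) (yes _) e′ f = s≤s z≤n
  ind-∪ (yes p) (no _) (yes _) f = ≤-refl
  ind-∪ (yes p) (no ¬q) (no ¬r) f = contradiction p (f ¬q ¬r)

  ind-cover : (d : Dec X) (e : Dec Y) → (¬ X → Y) → 1 ≤ ind d + ind e
  ind-cover (yes _) e f = s≤s z≤n
  ind-cover (no ¬p) e f = ≤-reflexive (sym (ind-yes e (f ¬p)))

  ind-¬ : (d : Dec X) (e : Dec Y) → (X → ¬ Y) → (¬ X → Y) → ind d + ind e ≡ 1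
  ind-¬ (yes p) e f g = cong suc (ind-no e (f p))
  ind-¬ (no ¬p) e f g = ind-yes e (g ¬p)

  opaque
    -- Opaque, so that sums over lists such as `units` or `vecsOf xs (suc j)` do not unfold and
    -- omitted summands can be inferred.
    ∑ : List A → (A → ℕ) → ℕ
    ∑ xs F = sum (map F xs)

    ∑-cong : ∀ (xs : List A) {F G : A → ℕ} → (∀ a → F a ≡ G a) → ∑ xs F ≡ ∑ xs G
    ∑-cong [] eq = refl
    ∑-cong (x ∷ xs) eq = cong₂ _+_ (eq x) (∑-cong xs eq)

    ∑-mono-∈ : ∀ (xs : List A) {F G : A → ℕ} → (∀ {a} → a ∈ xs → F a ≤ G a) → ∑ xs F ≤ ∑ xs G
    ∑-mono-∈ [] le = z≤n
    ∑-mono-∈ (x ∷ xs) le = +-mono-≤ (le (here refl)) (∑-mono-∈ xs (λ m → le (there m)))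

    ∑-mono : ∀ (xs : List A) {F G : A → ℕ} → (∀ a → F a ≤ G a) → ∑ xs F ≤ ∑ xs G
    ∑-mono xs le = ∑-mono-∈ xs (λ {a} _ → le a)

    ∑-singleton : ∀ (a : A) (F : A → ℕ) → ∑ (a ∷ []) F ≡ F a
    ∑-singleton a F = +-identityʳ (F a)

    ∑-+ : ∀ (xs : List A) (F G : A → ℕ) → ∑ xs (λ a → F a + G a) ≡ ∑ xs F + ∑ xs G
    ∑-+ [] F G = refl
    ∑-+ (x ∷ xs) F G = trans (cong (F x + G x +_) (∑-+ xs F G)) (interchange (F x) (G x) (∑ xs F) (∑ xs G))
      where
      interchange : ∀ a b c d → a + b + (c + d) ≡ a + c + (b + d)
      interchange = solve-∀

    ∑-* : ∀ c (xs : List A) (F : A → ℕ) → ∑ xs (λ a → c * F a) ≡ c * ∑ xs F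
    ∑-* c [] F = sym (*-zeroʳ c)
    ∑-* c (x ∷ xs) F = trans (cong (c * F x +_) (∑-* c xs F)) (sym (*-distribˡ-+ c (F x) (∑ xs F)))

    ∑-const : ∀ (xs : List A) c → ∑ xs (λ _ → c) ≡ length xs * c
    ∑-const [] c = refl
    ∑-const (x ∷ xs) c = cong (c +_) (∑-const xs c)

    ∑-swap : ∀ (xs : List A) (ys : List A′) (F : A → A′ → ℕ) →
             ∑ xs (λ a → ∑ ys (F a)) ≡ ∑ ys (λ b → ∑ xs (λ a → F a b))
    ∑-swap [] ys F = sym (trans (∑-const ys 0) (*-zeroʳ (length ys)))
    ∑-swap (x ∷ xs) ys F =
      trans (cong (∑ ys (F x) +_) (∑-swap xs ys F)) (sym (∑-+ ys (F x) _))

    ∑-++ : ∀ (xs ys : List A) (F : A → ℕ) → ∑ (xs ++ ys) F ≡ ∑ xs F + ∑ ys F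
    ∑-++ xs ys F = trans (cong sum (map-++ F xs ys)) (sum-++ (map F xs) (map F ys))

    ∑-map : ∀ (g : A → A′) xs (F : A′ → ℕ) → ∑ (map g xs) F ≡ ∑ xs (F ∘ g)
    ∑-map g xs F = cong sum (sym (map-∘ xs))

    ∑-concatMap : ∀ (g : A → List A′) xs (F : A′ → ℕ) → ∑ (concatMap g xs) F ≡ ∑ xs (λ a → ∑ (g a) F)
    ∑-concatMap g [] F = refl
    ∑-concatMap g (x ∷ xs) F = trans (∑-++ (g x) _ F) (cong (∑ (g x) F +_) (∑-concatMap g xs F))

    ∑-cartesianProduct : ∀ (xs : List A) (ys : List A′) (F : A × A′ → ℕ) →
                         ∑ (cartesianProduct xs ys) F ≡ ∑ xs (λ a → ∑ ys (λ b → F (a , b)))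
    ∑-cartesianProduct [] ys F = refl
    ∑-cartesianProduct (x ∷ xs) ys F =
      trans (∑-++ (map (x ,_) ys) _ F) (cong₂ _+_ (∑-map (x ,_) ys F) (∑-cartesianProduct xs ys F))

    ∑-vecsOf-suc : ∀ (xs : List A) m (F : Vec A (suc m) → ℕ) →
                   ∑ (vecsOf xs (suc m)) F ≡ ∑ xs (λ a → ∑ (vecsOf xs m) (λ v → F (a ∷ v)))
    ∑-vecsOf-suc xs m F = trans (∑-concatMap (λ a → map (a ∷_) (vecsOf xs m)) xs F)
      (∑-cong xs (λ a → ∑-map (a ∷_) (vecsOf xs m) F))

    length-filter-∑ : ∀ {P : A → Set} (P? : Decidable P) xs → length (filter P? xs) ≡ ∑ xs (λ a → ind (P? a))
    length-filter-∑ P? [] = refl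
    length-filter-∑ P? (x ∷ xs) with P? x
    ... | yes _ = cong suc (length-filter-∑ P? xs)
    ... | no _ = length-filter-∑ P? xs

    ∃-below-average : ∀ (xs : List A) (F : A → ℕ) c → ∑ xs F < length xs * c → ∃ λ a → a ∈ xs × F a < c
    ∃-below-average (x ∷ xs) F c lt with F x <? c
    ... | yes fx<c = x , here refl , fx<c
    ... | no fx≮c with ∃-below-average xs F c (+-cancelˡ-< c _ _ (≤-<-trans (+-monoˡ-≤ (∑ xs F) (≮⇒≥ fx≮c)) lt))
    ... | a , a∈ , fa<c = a , there a∈ , fa<c

    ∑-atMostOne : ∀ {P : A → Set} (P? : Decidable P) {xs} → Unique xs →
                  (∀ {a b} → a ∈ xs → b ∈ xs → P a → P b → a ≡ b) → ∑ xs (λ a → ind (P? a)) ≤ 1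
    ∑-atMostOne P? [] _ = z≤n
    ∑-atMostOne {P = P} P? {x ∷ xs} (x∉ ∷ u) same with P? x
    ... | no _ = ∑-atMostOne P? u (λ a∈ b∈ → same (there a∈) (there b∈))
    ... | yes px = s≤s (subst (∑ xs (λ a → ind (P? a)) ≤_) (trans (∑-const xs 0) (*-zeroʳ (length xs)))
      (∑-mono-∈ xs (λ {a} a∈ → ≤-reflexive (ind-no (P? a)
        (λ pa → All.lookup x∉ a∈ (same (here refl) (there a∈) px pa))))))

  -- Gives access to uniqueness and membership results for Cartesian products.
  vecsOf-suc : ∀ (xs : List A) m → vecsOf xs (suc m) ≡ cartesianProductWith _∷_ xs (vecsOf xs m)
  vecsOf-suc xs m = go xs
    where
    go : ∀ ys → concatMap (λ a → map (a ∷_) (vecsOf xs m)) ys ≡ cartesianProductWith _∷_ ys (vecsOf xs m)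
    go [] = refl
    go (y ∷ ys) = cong (map (y ∷_) (vecsOf xs m) ++_) (go ys)

  length-∑ : ∀ (xs : List A) → length xs ≡ ∑ xs (λ _ → 1)
  length-∑ xs = sym (trans (∑-const xs 1) (*-identityʳ (length xs)))

  length-vecsOf : ∀ (xs : List A) m → length (vecsOf xs m) ≡ length xs ^ m
  length-vecsOf xs zero = refl
  length-vecsOf xs (suc m) = begin
    length (vecsOf xs (suc m))                ≡⟨ length-∑ (vecsOf xs (suc m)) ⟩
    ∑ (vecsOf xs (suc m)) (λ _ → 1)           ≡⟨ ∑-vecsOf-suc xs m _ ⟩
    ∑ xs (λ _ → ∑ (vecsOf xs m) (λ _ → 1))    ≡⟨ ∑-const xs _ ⟩
    length xs * ∑ (vecsOf xs m) (λ _ → 1)     ≡⟨ cong (length xs *_) (length-∑ (vecsOf xs m)) ⟨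
    length xs * length (vecsOf xs m)          ≡⟨ cong (length xs *_) (length-vecsOf xs m) ⟩
    length xs * length xs ^ m                 ∎
    where open ≡-Reasoning

  vecsOf-Unique : ∀ {xs : List A} → Unique xs → ∀ m → Unique (vecsOf xs m)
  vecsOf-Unique u zero = All.[] ∷ []
  vecsOf-Unique {xs = xs} u (suc m) = subst Unique (sym (vecsOf-suc xs m))
    (Unique.cartesianProductWith⁺ _∷_ ∷-injective u (vecsOf-Unique u m))

  ∈-vecsOf : ∀ {xs : List A} → (∀ a → a ∈ xs) → ∀ {m} (v : Vec A m) → v ∈ vecsOf xs m
  ∈-vecsOf c [] = here refl
  ∈-vecsOf {xs = xs} c {suc m} (a ∷ v) = subst (a ∷ v ∈_) (sym (vecsOf-suc xs m))
    (∈-cartesianProductWith⁺ _∷_ (c a) (∈-vecsOf c v))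

  opaque
    unfolding ∑

    -- A bijection sends a complete list without repetitions to another such list. Two of these with
    -- the same members are permutations of each other, and a sum ignores order.
    ∑-reindex : ∀ {xs : List A} → Unique xs → (∀ a → a ∈ xs) → (π π⁻¹ : A → A) →
                (∀ a → π (π⁻¹ a) ≡ a) → (∀ a → π⁻¹ (π a) ≡ a) →
                ∀ F → ∑ xs (F ∘ π) ≡ ∑ xs F
    ∑-reindex {xs = xs} u c π π⁻¹ r l F = trans (sym (∑-map π xs F)) (sum-↭ permuted)
      where
      permuted : map F (map π xs) ↭ map F xs
      permuted = map⁺ F (∼bag⇒↭ (unique∧set⇒bag
        (Unique.map⁺ (λ {a} {b} e → trans (sym (l a)) (trans (cong π⁻¹ e) (l b))) u) u
        (λ {a} → mk⇔ (λ _ → c a) (λ _ → subst (_∈ map π xs) (r a) (∈-map⁺ π (c (π⁻¹ a)))))))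

  ∑-cong-∈ : ∀ (xs : List A) {F G : A → ℕ} → (∀ {a} → a ∈ xs → F a ≡ G a) → ∑ xs F ≡ ∑ xs G
  ∑-cong-∈ xs eq = ≤-antisym (∑-mono-∈ xs (λ a∈ → ≤-reflexive (eq a∈))) (∑-mono-∈ xs (λ a∈ → ≤-reflexive (sym (eq a∈))))

  ∑-product : ∀ (xs : List A) (ys : List A′) F G → ∑ xs (λ a → ∑ ys (λ b → F a * G b)) ≡ ∑ xs F * ∑ ys G
  ∑-product xs ys F G = trans (∑-cong xs (λ a → trans (∑-* (F a) ys G) (*-comm (F a) (∑ ys G))))
    (trans (∑-* (∑ ys G) xs F) (*-comm (∑ ys G) (∑ xs F)))

  ∑-complement : ∀ {P Q : A → Set} (xs : List A) (P? : ∀ a → Dec (P a)) (Q? : ∀ a → Dec (Q a)) →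
                 (∀ a → P a → ¬ Q a) → (∀ a → ¬ P a → Q a) →
                 ∑ xs (λ a → ind (P? a)) + ∑ xs (λ a → ind (Q? a)) ≡ length xs
  ∑-complement xs P? Q? f g = trans (sym (∑-+ xs _ _))
    (trans (∑-cong xs (λ a → ind-¬ (P? a) (Q? a) (f a) (g a))) (sym (length-∑ xs)))

  length-cartesianProduct : ∀ (xs : List A) (ys : List A′) → length (cartesianProduct xs ys) ≡ length xs * length ys
  length-cartesianProduct xs ys = trans (length-∑ (cartesianProduct xs ys))
    (trans (∑-cartesianProduct xs ys _) (trans (∑-const xs _) (cong (length xs *_) (sym (length-∑ ys)))))

  -- The factor `c` clears the denominator of a probability bound. Every later choice of a fixed
  -- coefficient, sample or base point is made by this principle.
  average : ∀ c (xs : List A) (F : A → ℕ) d → c * ∑ xs F < length xs * d → ∃ λ a → a ∈ xs × c * F a < d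
  average c xs F d lt = ∃-below-average xs (λ a → c * F a) d (subst (_< length xs * d) (sym (∑-* c xs F)) lt)

  -- Adding one to every summand keeps each at most `c` and raises the sum by `length xs`, which is
  -- positive; strictness comes from there.
  ∑-<-const : ∀ (xs : List A) (F : A → ℕ) c → 0 < length xs → (∀ a → F a < c) → ∑ xs F < length xs * c
  ∑-<-const xs F c 0<l F<c = begin-strict
    ∑ xs F                    <⟨ m<n+m (∑ xs F) 0<l ⟩
    length xs + ∑ xs F        ≡⟨ cong (_+ ∑ xs F) (length-∑ xs) ⟩
    ∑ xs (λ _ → 1) + ∑ xs F   ≡⟨ ∑-+ xs _ F ⟨
    ∑ xs (λ a → suc (F a))    ≤⟨ ∑-mono xs F<c ⟩
    ∑ xs (λ _ → c)            ≡⟨ ∑-const xs c ⟩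
    length xs * c             ∎
    where open ≤-Reasoning

  ind¬≡0⇒ : ∀ {P : Set} (d : Dec P) → ind (¬? d) ≡ 0 → P
  ind¬≡0⇒ (yes p) _ = p

  ^-distribˡ-* : ∀ a b m → (a * b) ^ m ≡ a ^ m * b ^ m
  ^-distribˡ-* a b zero = refl
  ^-distribˡ-* a b (suc m) = trans (cong (a * b *_) (^-distribˡ-* a b m)) (eq a b (a ^ m) (b ^ m))
    where
    eq : ∀ a b x y → a * b * (x * y) ≡ a * x * (b * y)
    eq = solve-∀

  -- Parity of a sum of independent biased bits.

  module Parity (xs : List A) (χ : A → 𝔽 2) where

    paritySum : ∀ {j} → Vec A j → 𝔽 2
    paritySum [] = fzero
    paritySum (a ∷ v) = addF (χ a) (paritySum v)

    zero? : ∀ (a : 𝔽 2) → Dec (a ≡ fzero)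
    zero? a = a ≟F fzero

    #even #odd : ℕ → ℕ
    #even j = ∑ (vecsOf xs j) (λ v → ind (zero? (paritySum v)))
    #odd j = ∑ (vecsOf xs j) (λ v → ind (¬? (zero? (paritySum v))))

    #χ₀ #χ₁ : ℕ
    #χ₀ = ∑ xs (λ a → ind (zero? (χ a)))
    #χ₁ = ∑ xs (λ a → ind (¬? (zero? (χ a))))

    private
      ind-even : ∀ a b → ind (zero? (addF a b)) ≡ ind (zero? a) * ind (zero? b) + ind (¬? (zero? a)) * ind (¬? (zero? b))
      ind-even fzero fzero = refl
      ind-even fzero (fsuc fzero) = refl
      ind-even (fsuc fzero) fzero = refl
      ind-even (fsuc fzero) (fsuc fzero) = refl

      ind-odd : ∀ a b → ind (¬? (zero? (addF a b))) ≡ ind (zero? a) * ind (¬? (zero? b)) + ind (¬? (zero? a)) * ind (zero? b)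
      ind-odd fzero fzero = refl
      ind-odd fzero (fsuc fzero) = refl
      ind-odd (fsuc fzero) fzero = refl
      ind-odd (fsuc fzero) (fsuc fzero) = refl

      -- Both recursions distinguish the parity of the head; each resulting product of a head factor
      -- and a tail factor sums to a product of sums.
      split : ∀ j (F : Vec A (suc j) → ℕ) (G₁ G₂ : A → ℕ) (H₁ H₂ : Vec A j → ℕ) →
              (∀ a v → F (a ∷ v) ≡ G₁ a * H₁ v + G₂ a * H₂ v) →
              ∑ (vecsOf xs (suc j)) F ≡ ∑ xs G₁ * ∑ (vecsOf xs j) H₁ + ∑ xs G₂ * ∑ (vecsOf xs j) H₂
      split j F G₁ G₂ H₁ H₂ eq = trans (∑-vecsOf-suc xs j F)
        (trans (∑-cong xs (λ a → trans (∑-cong (vecsOf xs j) (eq a)) (∑-+ (vecsOf xs j) _ _)))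
        (trans (∑-+ xs _ _) (cong₂ _+_ (∑-product xs (vecsOf xs j) G₁ H₁) (∑-product xs (vecsOf xs j) G₂ H₂))))

    #even-suc : ∀ j → #even (suc j) ≡ #χ₀ * #even j + #χ₁ * #odd j
    #even-suc j = split j _ _ _ _ _ (λ a v → ind-even (χ a) (paritySum v))

    #odd-suc : ∀ j → #odd (suc j) ≡ #χ₀ * #odd j + #χ₁ * #even j
    #odd-suc j = split j _ _ _ _ _ (λ a v → ind-odd (χ a) (paritySum v))

    rearrangement : ∀ {a b c d} → a ≤ b → c ≤ d → a * d + b * c ≤ a * c + b * d
    -- With b = a + x and d = c + y the two sides differ by exactly x * y.
    rearrangement {a} {b} {c} {d} a≤b c≤d = subst₂ (λ b d → a * d + b * c ≤ a * c + b * d)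
      (m+[n∸m]≡n a≤b) (m+[n∸m]≡n c≤d) (≤-trans (m≤m+n _ ((b ∸ a) * (d ∸ c))) (≤-reflexive (eq a (b ∸ a) c (d ∸ c))))
      where
      eq : ∀ a x c y → a * (c + y) + (a + x) * c + x * y ≡ a * c + (a + x) * (c + y)
      eq = solve-∀

    -- #even j − #odd j is the j-th power of #χ₀ − #χ₁ ≤ 0.
    #even≤#odd : #χ₀ ≤ #χ₁ → ∀ k → #even (suc (k * 2)) ≤ #odd (suc (k * 2))
    #odd≤#even : #χ₀ ≤ #χ₁ → ∀ k → #odd (k * 2) ≤ #even (k * 2)
    #even≤#odd le k = subst₂ _≤_ (sym (#even-suc (k * 2))) (sym (#odd-suc (k * 2)))
      (rearrangement le (#odd≤#even le k))
    #odd≤#even le zero = ≤-trans (≤-reflexive (∑-singleton _ _)) z≤n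
    #odd≤#even le (suc k) = subst₂ _≤_ (sym (#odd-suc (suc (k * 2)))) (sym (#even-suc (suc (k * 2))))
      (rearrangement le (#even≤#odd le k))

    -- The even and odd counts exhaust all vectors, and for an odd number of bits the odd count is
    -- at least the even one.
    half : #χ₀ ≤ #χ₁ → ∀ k → length xs ^ suc (k * 2) ≤ 2 * #odd (suc (k * 2))
    half le k = begin
      length xs ^ suc (k * 2)                   ≡⟨ length-vecsOf xs (suc (k * 2)) ⟨
      length (vecsOf xs (suc (k * 2)))          ≡⟨ ∑-complement (vecsOf xs (suc (k * 2))) (λ v → zero? (paritySum v))
                                                    (λ v → ¬? (zero? (paritySum v))) (λ _ e ne → ne e) (λ _ ne → ne) ⟨
      #even (suc (k * 2)) + #odd (suc (k * 2))  ≤⟨ +-monoˡ-≤ _ (#even≤#odd le k) ⟩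
      #odd (suc (k * 2)) + #odd (suc (k * 2))   ≡⟨ eq (#odd (suc (k * 2))) ⟩
      2 * #odd (suc (k * 2))                    ∎
      where
      open ≤-Reasoning
      eq : ∀ o → o + o ≡ 2 * o
      eq = solve-∀

  -- Arithmetic of the prime field and of vectors over it.

  module PrimeField (q : ℕ) (p-prime : Prime (suc q)) where

    𝕂 : Set
    𝕂 = 𝔽 (suc q)

    -- Reduction modulo p. It respects sums and products, so the ring laws below are those of ℕ
    -- pushed through it.
    [_] : ℕ → 𝕂
    [ m ] = m mod suc q

    toℕ-[] : ∀ m → toℕ [ m ] ≡ m % suc q
    toℕ-[] m = toℕ-fromℕ< (m%n<n m (suc q))

    []-cong-% : ∀ m n → m % suc q ≡ n % suc q → [ m ] ≡ [ n ]
    []-cong-% m n e = toℕ-injective (trans (toℕ-[] m) (trans e (sym (toℕ-[] n))))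

    []-toℕ : ∀ a → [ toℕ a ] ≡ a
    []-toℕ a = toℕ-injective (trans (toℕ-[] (toℕ a)) (m<n⇒m%n≡m (toℕ<n a)))

    addF-[] : ∀ m n → addF [ m ] [ n ] ≡ [ m + n ]
    addF-[] m n = []-cong-% (toℕ [ m ] + toℕ [ n ]) (m + n) (trans (cong (_% suc q) (cong₂ _+_ (toℕ-[] m) (toℕ-[] n))) (sym (%-distribˡ-+ m n (suc q))))

    mulF-[] : ∀ m n → mulF [ m ] [ n ] ≡ [ m * n ]
    mulF-[] m n = []-cong-% (toℕ [ m ] * toℕ [ n ]) (m * n) (trans (cong (_% suc q) (cong₂ _*_ (toℕ-[] m) (toℕ-[] n))) (sym (%-distribˡ-* m n (suc q))))

    addF-[]ˡ : ∀ m a → addF [ m ] a ≡ [ m + toℕ a ]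
    addF-[]ˡ m a = trans (cong (addF [ m ]) (sym ([]-toℕ a))) (addF-[] m (toℕ a))

    addF-[]ʳ : ∀ a m → addF a [ m ] ≡ [ toℕ a + m ]
    addF-[]ʳ a m = trans (cong (λ b → addF b [ m ]) (sym ([]-toℕ a))) (addF-[] (toℕ a) m)

    mulF-[]ˡ : ∀ m a → mulF [ m ] a ≡ [ m * toℕ a ]
    mulF-[]ˡ m a = trans (cong (mulF [ m ]) (sym ([]-toℕ a))) (mulF-[] m (toℕ a))

    mulF-[]ʳ : ∀ a m → mulF a [ m ] ≡ [ toℕ a * m ]
    mulF-[]ʳ a m = trans (cong (λ b → mulF b [ m ]) (sym ([]-toℕ a))) (mulF-[] (toℕ a) m)

    addF-assoc : ∀ a b c → addF (addF a b) c ≡ addF a (addF b c)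
    addF-assoc a b c = trans (addF-[]ˡ (toℕ a + toℕ b) c)
      (trans (cong [_] (+-assoc (toℕ a) (toℕ b) (toℕ c))) (sym (addF-[]ʳ a (toℕ b + toℕ c))))

    addF-comm : ∀ a b → addF a b ≡ addF b a
    addF-comm a b = cong [_] (+-comm (toℕ a) (toℕ b))

    addF-identityˡ : ∀ a → addF fzero a ≡ a
    addF-identityˡ = []-toℕ

    mulF-assoc : ∀ a b c → mulF (mulF a b) c ≡ mulF a (mulF b c)
    mulF-assoc a b c = trans (mulF-[]ˡ (toℕ a * toℕ b) c)
      (trans (cong [_] (*-assoc (toℕ a) (toℕ b) (toℕ c))) (sym (mulF-[]ʳ a (toℕ b * toℕ c))))

    mulF-comm : ∀ a b → mulF a b ≡ mulF b a
    mulF-comm a b = cong [_] (*-comm (toℕ a) (toℕ b))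

    mulF-distribˡ : ∀ a b c → mulF a (addF b c) ≡ addF (mulF a b) (mulF a c)
    mulF-distribˡ a b c = trans (mulF-[]ʳ a (toℕ b + toℕ c))
      (trans (cong [_] (*-distribˡ-+ (toℕ a) (toℕ b) (toℕ c))) (sym (addF-[] (toℕ a * toℕ b) (toℕ a * toℕ c))))

    -- Multiplication by `q` = p - 1, which is -1 modulo p; this avoids truncated subtraction.
    negF : 𝕂 → 𝕂
    negF a = [ q * toℕ a ]

    []-multiple : ∀ m → [ m * suc q ] ≡ fzero
    []-multiple m = []-cong-% (m * suc q) 0 (m*n%n≡0 m (suc q))

    addF-inverseˡ : ∀ a → addF (negF a) a ≡ fzero
    addF-inverseˡ a = trans (addF-[]ˡ (q * toℕ a) a) (trans (cong [_] (eq q (toℕ a))) ([]-multiple (toℕ a)))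
      where
      eq : ∀ q t → q * t + t ≡ t * suc q
      eq = solve-∀

    private
      Bézout⇒inverse : ∀ {n} → Bézout.Identity 1 (suc q) n → ∃ λ m → [ m * n ] ≡ [ 1 ]
      Bézout⇒inverse {n} (Bézout.-+ x y 1+xp≡yn) = y ,
        trans (cong [_] (sym 1+xp≡yn)) ([]-cong-% (1 + x * suc q) 1 ([m+kn]%n≡m%n 1 x (suc q)))
      -- Here y n is -1 modulo p, so the inverse is -y, represented by `q * y`. Adding one copy of p
      -- turns q y n into 1 + q (1 + y n), and 1 + y n is a multiple of p.
      Bézout⇒inverse {n} (Bézout.+- x y 1+yn≡xp) = q * y ,
        trans ([]-cong-% (q * y * n) (1 + q * (1 + y * n)) (trans (sym ([m+kn]%n≡m%n (q * y * n) 1 (suc q))) (cong (_% suc q) (eq₁ q y n))))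
          (trans (cong (λ t → [ 1 + q * t ]) 1+yn≡xp) (trans (cong [_] (eq₂ q x)) ([]-cong-% (1 + q * x * suc q) 1 ([m+kn]%n≡m%n 1 (q * x) (suc q)))))
        where
        eq₁ : ∀ q y n → q * y * n + 1 * suc q ≡ 1 + q * (1 + y * n)
        eq₁ = solve-∀
        eq₂ : ∀ q x → 1 + q * (x * suc q) ≡ 1 + q * x * suc q
        eq₂ = solve-∀

    -- The inverse is described by its action on every `c`, the form that lifts entrywise to `⊙`.
    inverse : ∀ (a : 𝕂) → a ≢ fzero → Σ 𝕂 λ b → ∀ c → mulF b (mulF a c) ≡ c
    inverse fzero a≢0 = contradiction refl a≢0
    inverse a@(fsuc _) a≢0 with Bézout⇒inverse (coprime-Bézout (prime⇒coprime p-prime (toℕ<n a)))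
    ... | m , e = [ m ] , λ c → trans (sym (mulF-assoc [ m ] a c))
      (trans (cong (λ t → mulF t c) (trans (mulF-[]ˡ m a) e))
      (trans (mulF-[]ˡ 1 c) (trans (cong [_] (*-identityˡ (toℕ c))) ([]-toℕ c))))

    inverseʳ : ∀ (a b : 𝕂) → (∀ c → mulF b (mulF a c) ≡ c) → ∀ c → mulF a (mulF b c) ≡ c
    inverseʳ a b inv c = trans (sym (mulF-assoc a b c))
      (trans (cong (λ t → mulF t c) (mulF-comm a b)) (trans (mulF-assoc b a c) (inv c)))

    mulF-zeroʳ : ∀ a → mulF a fzero ≡ fzero
    mulF-zeroʳ a = cong [_] (*-zeroʳ (toℕ a))

    mulF-cancelʳ : ∀ c → c ≢ fzero → ∀ a b → mulF a c ≡ mulF b c → a ≡ b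
    mulF-cancelʳ c c≢0 a b e with inverse c c≢0
    ... | c⁻¹ , inv = trans (sym (inv a)) (trans (cong (mulF c⁻¹) (trans (mulF-comm c a) (trans e (mulF-comm b c)))) (inv b))

    V : ℕ → Set
    V n = 𝔽^ (suc q) n

    𝟎 : ∀ {n} → V n
    𝟎 = 𝟘 fzero

    ⊖_ : ∀ {n} → V n → V n
    ⊖_ = Vec.map negF

    _≟V_ : ∀ {n} (x y : V n) → Dec (x ≡ y)
    _≟V_ = ≡-dec _≟F_

    V-abelianGroup : ℕ → AbelianGroup 0ℓ 0ℓ
    V-abelianGroup n = record
      { Carrier = V n ; _≈_ = _≡_ ; _∙_ = _⊕_ ; ε = 𝟎 ; _⁻¹ = ⊖_
      ; isAbelianGroup = record
        { isGroup = record
          { isMonoid = record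
            { isSemigroup = record
              { isMagma = record { isEquivalence = isEquivalence ; ∙-cong = cong₂ _⊕_ }
              ; assoc = zipWith-assoc addF-assoc }
            ; identity = zipWith-identityˡ addF-identityˡ
                       , zipWith-identityʳ (λ a → trans (addF-comm a fzero) (addF-identityˡ a)) }
          ; inverse = zipWith-inverseˡ addF-inverseˡ
                    , zipWith-inverseʳ (λ a → trans (addF-comm a (negF a)) (addF-inverseˡ a))
          ; ⁻¹-cong = cong ⊖_ }
        ; comm = zipWith-comm addF-comm } }

    module _ {n : ℕ} where
      open AbelianGroup (V-abelianGroup n) public using ()
        renaming (assoc to ⊕-assoc; comm to ⊕-comm; identityˡ to ⊕-identityˡ; identityʳ to ⊕-identityʳ;
                  inverseˡ to ⊕-inverseˡ; inverseʳ to ⊕-inverseʳ)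
      open import Algebra.Properties.AbelianGroup (V-abelianGroup n) public using ()
        renaming (∙-cancelˡ to ⊕-cancelˡ; ∙-cancelʳ to ⊕-cancelʳ; ⁻¹-∙-comm to ⊖-⊕-comm)
      open import Algebra.Properties.CommutativeSemigroup (AbelianGroup.commutativeSemigroup (V-abelianGroup n)) public using ()
        renaming (interchange to ⊕-interchange; xy∙z≈xz∙y to ⊕-swapʳ; x∙yz≈xz∙y to ⊕-pullʳ)

    ⊙-distrib-⊕ : ∀ {n} c (x y : V n) → c ⊙ (x ⊕ y) ≡ (c ⊙ x) ⊕ (c ⊙ y)
    ⊙-distrib-⊕ c [] [] = refl
    ⊙-distrib-⊕ c (a ∷ x) (b ∷ y) = cong₂ _∷_ (mulF-distribˡ c a b) (⊙-distrib-⊕ c x y)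

    ⊙-inverse : ∀ {n} (c d : 𝕂) → (∀ a → mulF d (mulF c a) ≡ a) → ∀ (x : V n) → d ⊙ (c ⊙ x) ≡ x
    ⊙-inverse c d inv x = trans (sym (Vec.map-∘ (mulF d) (mulF c) x)) (trans (map-cong inv x) (map-id x))

    ⊙-zeroʳ : ∀ {n} c → c ⊙ 𝟎 {n} ≡ 𝟎
    ⊙-zeroʳ {zero} c = refl
    ⊙-zeroʳ {suc n} c = cong₂ _∷_ (mulF-zeroʳ c) (⊙-zeroʳ {n} c)

    ⊙-[0] : ∀ {n} (x : V n) → [ 0 ] ⊙ x ≡ 𝟎
    ⊙-[0] [] = refl
    ⊙-[0] (a ∷ x) = cong (fzero ∷_) (⊙-[0] x)

    ⊙-[suc] : ∀ {n} s (x : V n) → [ suc s ] ⊙ x ≡ x ⊕ ([ s ] ⊙ x)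
    ⊙-[suc] s [] = refl
    ⊙-[suc] s (a ∷ x) = cong₂ _∷_
      (trans (mulF-[]ˡ (suc s) a) (sym (trans (cong (addF a) (mulF-[]ˡ s a)) (addF-[]ʳ a (s * toℕ a)))))
      (⊙-[suc] s x)

    hom-𝟎 : ∀ {n r} {h : V n → V r} → IsHom h → h 𝟎 ≡ 𝟎
    hom-𝟎 {h = h} hom = ⊕-cancelˡ (h 𝟎) _ _
      (trans (sym (hom 𝟎 𝟎)) (trans (cong h (⊕-identityˡ 𝟎)) (sym (⊕-identityʳ (h 𝟎)))))

    -- Over a prime field every scalar is the residue of a natural number, so `c ⊙ x` is a repeated
    -- sum of `x`, and additivity already gives linearity.
    hom-⊙ : ∀ {n r} {h : V n → V r} → IsHom h → ∀ c x → h (c ⊙ x) ≡ c ⊙ h x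
    hom-⊙ {h = h} hom c x = subst (λ c → h (c ⊙ x) ≡ c ⊙ h x) ([]-toℕ c) (go (toℕ c))
      where
      go : ∀ s → h ([ s ] ⊙ x) ≡ [ s ] ⊙ h x
      go zero = trans (cong h (⊙-[0] x)) (trans (hom-𝟎 hom) (sym (⊙-[0] (h x))))
      go (suc s) = trans (cong h (⊙-[suc] s x)) (trans (hom x _)
        (trans (cong (h x ⊕_) (go s)) (sym (⊙-[suc] s (h x)))))

    -- Points, nonzero coefficients and changes of variable.

    points : ∀ n → List (V n)
    points = allPoints (suc q)

    units : List 𝕂
    units = nonzero (suc q)

    ∈-units⇒≢0 : ∀ {c} → c ∈ units → c ≢ fzero
    ∈-units⇒≢0 c∈ = proj₂ (∈-filter⁻ (λ c → ¬? (c ≟F fzero)) {xs = allFin (suc q)} c∈)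

    units-Unique : Unique units
    units-Unique = Unique.filter⁺ (λ c → ¬? (c ≟F fzero)) (Unique.allFin⁺ (suc q))

    ∑-bijection : ∀ {n} (π π⁻¹ : V n → V n) → (∀ x → π (π⁻¹ x) ≡ x) → (∀ x → π⁻¹ (π x) ≡ x) →
                  ∀ F → ∑ (points n) (F ∘ π) ≡ ∑ (points n) F
    ∑-bijection {n} = ∑-reindex (vecsOf-Unique (Unique.allFin⁺ (suc q)) n) (∈-vecsOf ∈-allFin)

    ⊖-cancelˡ : ∀ {n} (u x : V n) → (⊖ u) ⊕ (u ⊕ x) ≡ x
    ⊖-cancelˡ u x = trans (sym (⊕-assoc (⊖ u) u x)) (trans (cong (_⊕ x) (⊕-inverseˡ u)) (⊕-identityˡ x))

    ⊕-⊖-cancelˡ : ∀ {n} (u x : V n) → u ⊕ ((⊖ u) ⊕ x) ≡ x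
    ⊕-⊖-cancelˡ u x = trans (sym (⊕-assoc u (⊖ u) x)) (trans (cong (_⊕ x) (⊕-inverseʳ u)) (⊕-identityˡ x))

    ∑-translateˡ : ∀ {n} (u : V n) F → ∑ (points n) (λ x → F (u ⊕ x)) ≡ ∑ (points n) F
    ∑-translateˡ u = ∑-bijection (u ⊕_) ((⊖ u) ⊕_) (⊕-⊖-cancelˡ u) (⊖-cancelˡ u)

    ∑-translateʳ : ∀ {n} (u : V n) F → ∑ (points n) (λ x → F (x ⊕ u)) ≡ ∑ (points n) F
    ∑-translateʳ u F = trans (∑-cong (points _) (λ x → cong F (⊕-comm x u))) (∑-translateˡ u F)

    ∑-dilate : ∀ {n} {c : 𝕂} → c ≢ fzero → ∀ (F : V n → ℕ) → ∑ (points n) (λ x → F (c ⊙ x)) ≡ ∑ (points n) F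
    ∑-dilate {c = c} c≢0 = ∑-bijection (c ⊙_) (d ⊙_) (⊙-inverse d c (inverseʳ c d inv)) (⊙-inverse c d inv)
      where
      d : 𝕂
      d = proj₁ (inverse c c≢0)
      inv : ∀ a → mulF d (mulF c a) ≡ a
      inv = proj₂ (inverse c c≢0)

    -- How often a sum of independent vectors is nonzero.

    vecSum : ∀ {A : Set} {r j} → (A → V r) → Vec A j → V r
    vecSum γ v = vsum fzero (Vec.map γ v)

    module _ {A : Set} {r : ℕ} (xs : List A) (γ : A → V r) where

      #nonzero : ℕ
      #nonzero = ∑ xs (λ a → ind (¬? (γ a ≟V 𝟎)))

      #nonzeroSums : ℕ → ℕ
      #nonzeroSums j = ∑ (vecsOf xs j) (λ v → ind (¬? (vecSum γ v ≟V 𝟎)))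

      -- A zero head leaves the sum unchanged. After a nonzero head the full sum and the tail sum
      -- cannot both vanish, so the two nonzero counts together cover all `length xs ^ j` tails. The
      -- negative term of the recursion is moved to the right to stay in ℕ.
      #nonzeroSums-suc : ∀ j → length xs * #nonzeroSums j + #nonzero * length xs ^ j
                             ≤ #nonzeroSums (suc j) + 2 * #nonzero * #nonzeroSums j
      #nonzeroSums-suc j = begin
        M * p + B * M ^ j
          ≡⟨ cong₂ _+_ (∑-const xs p) (trans (∑-* (M ^ j) xs i) (*-comm (M ^ j) B)) ⟨
        ∑ xs (λ _ → p) + ∑ xs (λ a → M ^ j * i a)
          ≡⟨ ∑-+ xs _ _ ⟨
        ∑ xs (λ a → p + M ^ j * i a)
          ≤⟨ ∑-mono xs extend ⟩
        ∑ xs (λ a → p′ a + 2 * p * i a)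
          ≡⟨ ∑-+ xs _ _ ⟩
        ∑ xs p′ + ∑ xs (λ a → 2 * p * i a)
          ≡⟨ cong₂ _+_ (sym (∑-vecsOf-suc xs j _)) (trans (∑-* (2 * p) xs i) (eq p B)) ⟩
        #nonzeroSums (suc j) + 2 * B * p ∎
        where
        open ≤-Reasoning
        M B p : ℕ
        M = length xs
        B = #nonzero
        p = #nonzeroSums j
        i p′ : A → ℕ
        i a = ind (¬? (γ a ≟V 𝟎))
        p′ a = ∑ (vecsOf xs j) (λ v → ind (¬? (vecSum γ (a ∷ v) ≟V 𝟎)))
        eq : ∀ p b → 2 * p * b ≡ 2 * b * p
        eq = solve-∀
        eq₀ : ∀ p m → p + m * 0 ≡ p
        eq₀ = solve-∀
        eq₁ : ∀ p p′ → p + (p′ + p) ≡ p′ + 2 * p * 1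
        eq₁ = solve-∀
        extend : ∀ a → p + M ^ j * i a ≤ p′ a + 2 * p * i a
        extend a with γ a ≟V 𝟎
        ... | yes γa≡0 = ≤-trans (≤-reflexive (eq₀ p (M ^ j))) (≤-trans
          (∑-mono (vecsOf xs j) (λ v → ind-mono (¬? (vecSum γ v ≟V 𝟎)) (¬? (vecSum γ (a ∷ v) ≟V 𝟎))
            (λ s≢0 e → s≢0 (trans (sym (trans (cong (_⊕ vecSum γ v) γa≡0) (⊕-identityˡ _))) e))))
          (m≤m+n (p′ a) (2 * p * 0)))
        ... | no γa≢0 = begin
          p + M ^ j * 1      ≡⟨ cong (λ t → p + t * 1) (length-vecsOf xs j) ⟨
          p + length (vecsOf xs j) * 1 ≡⟨ cong (p +_) (∑-const (vecsOf xs j) 1) ⟨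
          p + ∑ (vecsOf xs j) (λ _ → 1) ≤⟨ +-monoʳ-≤ p (∑-mono (vecsOf xs j) (λ v →
              ind-cover (¬? (vecSum γ (a ∷ v) ≟V 𝟎)) (¬? (vecSum γ v ≟V 𝟎))
                (λ a+v≡0 v≡0 → a+v≡0 (λ e → γa≢0 (trans (sym (trans (cong (γ a ⊕_) v≡0) (⊕-identityʳ _))) e))))) ⟩
          p + ∑ (vecsOf xs j) (λ v → ind (¬? (vecSum γ (a ∷ v) ≟V 𝟎)) + ind (¬? (vecSum γ v ≟V 𝟎)))
            ≡⟨ cong (p +_) (∑-+ (vecsOf xs j) _ _) ⟩
          p + (p′ a + p)     ≡⟨ eq₁ p (p′ a) ⟩
          p′ a + 2 * p * 1   ∎

      -- With η = #nonzero / length xs this is π_j ≥ jη / (1 + 2jη), which the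
      -- recursion π_{j+1} ≥ η + (1 − 2η) π_j preserves.
      #nonzeroSums-lower : 2 * #nonzero ≤ length xs → ∀ j →
        j * #nonzero * length xs ^ j ≤ #nonzeroSums j * (length xs + 2 * (j * #nonzero))
      #nonzeroSums-lower 2B≤M zero = z≤n
      #nonzeroSums-lower 2B≤M (suc j) = begin
        suc j * B * (M * Q)                      ≡⟨ cong (λ t → suc j * B * (t * Q)) M≡ ⟩
        suc j * B * ((2 * B + E) * Q)            ≡⟨ eq₁ j B E Q ⟩
        E * (j * B * Q) + B * Q * (2 * B + E + 2 * (j * B)) ≡⟨ cong (λ t → E * (j * B * Q) + B * Q * (t + 2 * (j * B))) M≡ ⟨
        E * (j * B * Q) + B * Q * D              ≤⟨ +-monoˡ-≤ (B * Q * D) (*-monoʳ-≤ E (#nonzeroSums-lower 2B≤M j)) ⟩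
        E * (p * D) + B * Q * D                  ≡⟨ eq₂ E p D B Q ⟩
        (E * p + B * Q) * D                      ≤⟨ *-monoˡ-≤ D step ⟩
        p′ * D                                   ≤⟨ *-monoʳ-≤ p′ (+-monoʳ-≤ M (*-monoʳ-≤ 2 (m≤n+m (j * B) B))) ⟩
        p′ * (M + 2 * (suc j * B))               ∎
        where
        open ≤-Reasoning
        M B E Q D p p′ : ℕ
        M = length xs
        B = #nonzero
        E = M ∸ 2 * B
        Q = M ^ j
        D = M + 2 * (j * B)
        p = #nonzeroSums j
        p′ = #nonzeroSums (suc j)
        M≡ : M ≡ 2 * B + E
        M≡ = sym (m+[n∸m]≡n 2B≤M)
        eq₁ : ∀ j B E Q → suc j * B * ((2 * B + E) * Q) ≡ E * (j * B * Q) + B * Q * (2 * B + E + 2 * (j * B))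
        eq₁ = solve-∀
        eq₂ : ∀ E p D B Q → E * (p * D) + B * Q * D ≡ (E * p + B * Q) * D
        eq₂ = solve-∀
        eq₃ : ∀ B p E Q → 2 * B * p + (E * p + B * Q) ≡ (2 * B + E) * p + B * Q
        eq₃ = solve-∀
        step : E * p + B * Q ≤ p′
        step = +-cancelˡ-≤ (2 * B * p) _ _ (≤-trans (≤-reflexive (eq₃ B p E Q))
          (≤-trans (subst (λ t → t * p + B * Q ≤ p′ + 2 * B * p) M≡ (#nonzeroSums-suc j)) (≤-reflexive (+-comm p′ (2 * B * p)))))

    -- The two sides of the test: `comb f` combines the answers, `comb id` is the last query.

    comb : ∀ {n r m} → (V n → V r) → Vec 𝕂 m → Vec (V n) m → V r
    comb g σs xs = vsum fzero (zipWith (λ s x → s ⊙ g x) σs xs)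

    comb-⊕ : ∀ {n r m} (f g : V n → V r) (σs : Vec 𝕂 m) xs →
             comb (λ x → f x ⊕ g x) σs xs ≡ comb f σs xs ⊕ comb g σs xs
    comb-⊕ f g [] [] = sym (⊕-identityˡ 𝟎)
    comb-⊕ f g (s ∷ σs) (x ∷ xs) = trans (cong₂ _⊕_ (⊙-distrib-⊕ s (f x) (g x)) (comb-⊕ f g σs xs))
      (⊕-interchange (s ⊙ f x) (s ⊙ g x) (comb f σs xs) (comb g σs xs))

    comb-hom : ∀ {n r m} {h : V n → V r} → IsHom h → (σs : Vec 𝕂 m) → ∀ xs →
               comb h σs xs ≡ h (comb id σs xs)
    comb-hom hom [] [] = sym (hom-𝟎 hom)
    comb-hom hom (s ∷ σs) (x ∷ xs) = trans
      (cong₂ _⊕_ (sym (hom-⊙ hom s x)) (comb-hom hom σs xs)) (sym (hom (s ⊙ x) (comb id σs xs)))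

    pairs : ∀ {n} → List (V n × 𝕂)
    pairs {n} = cartesianProduct (points n) units

    module _ {n r : ℕ} where

      #rejecting : ℕ → (V n → V r) → ℕ
      #rejecting m f = ∑ (vecsOf (points n) m) (λ xs → ∑ (vecsOf units m) (λ σs → ind (rejects? f xs σs)))

      -- A homomorphism commutes with linear combinations, so adding one changes both sides of the
      -- test equation equally. This permits passing from f to f - φ.
      #rejecting-⊕-hom : ∀ m {f h : V n → V r} → IsHom h → #rejecting m (λ x → f x ⊕ h x) ≤ #rejecting m f
      #rejecting-⊕-hom m {f} {h} hom = ∑-mono (vecsOf (points n) m) (λ xs → ∑-mono (vecsOf units m) (λ σs →
        ind-mono (rejects? (λ x → f x ⊕ h x) xs σs) (rejects? f xs σs)
          (λ rej acc → rej (trans (comb-⊕ f h σs xs) (cong₂ _⊕_ acc (comb-hom hom σs xs))))))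

      weighted : (V n → V r) → V n × 𝕂 → V r
      weighted g (x , s) = s ⊙ g x

      -- Regroups the points and the coefficients into independent pairs, so that the weighted sum
      -- becomes a `vecSum` of independent terms and the bounds for those apply.
      ∑-vecsOf-pairs : ∀ m (F : Vec (V n) m → Vec 𝕂 m → ℕ) →
        ∑ (vecsOf (points n) m) (λ xs → ∑ (vecsOf units m) (F xs))
          ≡ ∑ (vecsOf pairs m) (λ v → F (Vec.map proj₁ v) (Vec.map proj₂ v))
      ∑-vecsOf-pairs zero F = trans (∑-singleton _ _) (trans (∑-singleton _ _) (sym (∑-singleton _ _)))
      ∑-vecsOf-pairs (suc m) F = begin
        ∑ (vecsOf (points n) (suc m)) (λ xs → ∑ (vecsOf units (suc m)) (F xs))
          ≡⟨ ∑-vecsOf-suc (points n) m _ ⟩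
        ∑ (points n) (λ x → ∑ (vecsOf (points n) m) (λ xs → ∑ (vecsOf units (suc m)) (F (x ∷ xs))))
          ≡⟨ ∑-cong (points n) (λ x → begin
               ∑ (vecsOf (points n) m) (λ xs → ∑ (vecsOf units (suc m)) (F (x ∷ xs)))
                 ≡⟨ ∑-cong (vecsOf (points n) m) (λ xs → ∑-vecsOf-suc units m (F (x ∷ xs))) ⟩
               ∑ (vecsOf (points n) m) (λ xs → ∑ units (λ s → ∑ (vecsOf units m) (λ σs → F (x ∷ xs) (s ∷ σs))))
                 ≡⟨ ∑-swap (vecsOf (points n) m) units _ ⟩
               ∑ units (λ s → ∑ (vecsOf (points n) m) (λ xs → ∑ (vecsOf units m) (λ σs → F (x ∷ xs) (s ∷ σs))))
                 ≡⟨ ∑-cong units (λ s → ∑-vecsOf-pairs m (λ xs σs → F (x ∷ xs) (s ∷ σs))) ⟩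
               ∑ units (λ s → ∑ (vecsOf pairs m) (λ v → F (x ∷ Vec.map proj₁ v) (s ∷ Vec.map proj₂ v))) ∎) ⟩
        ∑ (points n) (λ x → ∑ units (λ s → ∑ (vecsOf pairs m) (λ v → F (x ∷ Vec.map proj₁ v) (s ∷ Vec.map proj₂ v))))
          ≡⟨ ∑-cartesianProduct (points n) units _ ⟨
        ∑ pairs (λ a → ∑ (vecsOf pairs m) (λ v → F (proj₁ a ∷ Vec.map proj₁ v) (proj₂ a ∷ Vec.map proj₂ v)))
          ≡⟨ ∑-vecsOf-suc pairs m _ ⟨
        ∑ (vecsOf pairs (suc m)) (λ v → F (Vec.map proj₁ v) (Vec.map proj₂ v)) ∎
        where open ≡-Reasoning

      comb-pairs : ∀ {m} (g : V n → V r) (v : Vec (V n × 𝕂) m) →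
        comb g (Vec.map proj₂ v) (Vec.map proj₁ v) ≡ vecSum (weighted g) v
      comb-pairs g [] = refl
      comb-pairs g ((x , s) ∷ v) = cong ((s ⊙ g x) ⊕_) (comb-pairs g v)

      -- With g equal to b off fewer than 1/8 of the points, x₁ ↦ (x₁, σ₁x₁ + c) hits
      -- the exceptional set with probability below 1/4.
      peel : ∀ (g : V n → V r) b {s : 𝕂} → s ≢ fzero → ∀ (G : V r) (c : V n) →
        8 * ∑ (points n) (λ x → ind (¬? (g x ≟V b))) < length (points n) →
        3 * length (points n) * ind (¬? (((s ⊙ b) ⊕ G) ≟V b))
          ≤ 4 * ∑ (points n) (λ x → ind (¬? (((s ⊙ g x) ⊕ G) ≟V g ((s ⊙ x) ⊕ c))))
      peel g b {s} s≢0 G c 8B<N with ((s ⊙ b) ⊕ G) ≟V b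
      ... | yes _ = ≤-trans (≤-reflexive (*-zeroʳ (3 * length (points n)))) z≤n
      ... | no sb+G≢b = +-cancelʳ-≤ (8 * B) _ _ (begin
        3 * N * 1 + 8 * B                              ≤⟨ +-monoʳ-≤ (3 * N * 1) (<⇒≤ 8B<N) ⟩
        3 * N * 1 + N                                  ≡⟨ eq₁ N ⟩
        4 * (N * 1)                                    ≡⟨ cong (4 *_) (∑-const (points n) 1) ⟨
        4 * ∑ (points n) (λ _ → 1)                     ≤⟨ *-monoʳ-≤ 4 (∑-mono (points n) bound) ⟩
        4 * ∑ (points n) (λ x → rej x + (bad x + bad ((s ⊙ x) ⊕ c)))
          ≡⟨ cong (4 *_) (trans (∑-+ (points n) rej _) (cong (∑ (points n) rej +_)
               (trans (∑-+ (points n) bad _) (cong (B +_)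
                 (trans (∑-dilate s≢0 (λ y → bad (y ⊕ c))) (∑-translateʳ c bad)))))) ⟩
        4 * (∑ (points n) rej + (B + B))               ≡⟨ eq₂ (∑ (points n) rej) B ⟩
        4 * ∑ (points n) rej + 8 * B                   ∎)
        where
        open ≤-Reasoning
        N B : ℕ
        rej bad : V n → ℕ
        N = length (points n)
        bad x = ind (¬? (g x ≟V b))
        rej x = ind (¬? (((s ⊙ g x) ⊕ G) ≟V g ((s ⊙ x) ⊕ c)))
        B = ∑ (points n) bad
        eq₁ : ∀ N → 3 * N * 1 + N ≡ 4 * (N * 1)
        eq₁ = solve-∀
        eq₂ : ∀ R B → 4 * (R + (B + B)) ≡ 4 * R + 8 * B
        eq₂ = solve-∀
        bound : ∀ x → 1 ≤ rej x + (bad x + bad ((s ⊙ x) ⊕ c))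
        bound x with g x ≟V b | g ((s ⊙ x) ⊕ c) ≟V b
        ... | no _ | _ = ≤-trans (s≤s z≤n) (m≤n+m _ (rej x))
        ... | yes _ | no _ = ≤-trans (s≤s z≤n) (m≤n+m _ (rej x))
        ... | yes e₁ | yes e₂ = ≤-trans (≤-reflexive (sym (ind-yes (¬? (((s ⊙ g x) ⊕ G) ≟V g ((s ⊙ x) ⊕ c)))
          (λ acc → sb+G≢b (trans (cong (λ t → (s ⊙ t) ⊕ G) (sym e₁)) (trans acc e₂)))))) (m≤m+n _ _)

      -- The choices of σ₁ and of the other samples that would be rejected if `g` had the value `b`
      -- both at the first sample and at the query.
      #offsetSums : (V n → V r) → V r → ℕ → ℕ
      #offsetSums g b j = ∑ units (λ s → ∑ (vecsOf pairs j) (λ v → ind (¬? (((s ⊙ b) ⊕ vecSum (weighted g) v) ≟V b))))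

      -- `peel` summed over σ₁ and the other `j` samples. The factors 3 and 4 express the
      -- conditional rejection probability of at least 3/4.
      #rejecting-lower : ∀ j (g : V n → V r) b →
        8 * ∑ (points n) (λ x → ind (¬? (g x ≟V b))) < length (points n) →
        3 * length (points n) * #offsetSums g b j ≤ 4 * #rejecting (suc j) g
      #rejecting-lower j g b 8B<N = begin
        3 * N * ∑ units (λ s → ∑ (vecsOf pairs j) (λ v → ind (goal? s v)))
          ≡⟨ ∑-* (3 * N) units _ ⟨
        ∑ units (λ s → 3 * N * ∑ (vecsOf pairs j) (λ v → ind (goal? s v)))
          ≡⟨ ∑-cong units (λ s → ∑-* (3 * N) (vecsOf pairs j) _) ⟨
        ∑ units (λ s → ∑ (vecsOf pairs j) (λ v → 3 * N * ind (goal? s v)))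
          ≤⟨ ∑-mono-∈ units (λ s∈ → ∑-mono (vecsOf pairs j) (λ v → peel′ s∈ v)) ⟩
        ∑ units (λ s → ∑ (vecsOf pairs j) (λ v → 4 * ∑ (points n) (λ x → rej x s v)))
          ≡⟨ ∑-cong units (λ s → ∑-* 4 (vecsOf pairs j) _) ⟩
        ∑ units (λ s → 4 * ∑ (vecsOf pairs j) (λ v → ∑ (points n) (λ x → rej x s v)))
          ≡⟨ ∑-* 4 units _ ⟩
        4 * ∑ units (λ s → ∑ (vecsOf pairs j) (λ v → ∑ (points n) (λ x → rej x s v)))
          ≡⟨ cong (4 *_) (∑-cong units (λ s → ∑-swap (vecsOf pairs j) (points n) _)) ⟩
        4 * ∑ units (λ s → ∑ (points n) (λ x → ∑ (vecsOf pairs j) (λ v → rej x s v)))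
          ≡⟨ cong (4 *_) (∑-swap units (points n) _) ⟩
        4 * ∑ (points n) (λ x → ∑ units (λ s → ∑ (vecsOf pairs j) (λ v → rej x s v)))
          ≡⟨ cong (4 *_) (∑-cartesianProduct (points n) units _) ⟨
        4 * ∑ pairs (λ a → ∑ (vecsOf pairs j) (λ v → rej (proj₁ a) (proj₂ a) v))
          ≡⟨ cong (4 *_) (∑-vecsOf-suc pairs j _) ⟨
        4 * ∑ (vecsOf pairs (suc j)) (λ v → ind (rejects? g (Vec.map proj₁ v) (Vec.map proj₂ v)))
          ≡⟨ cong (4 *_) (∑-vecsOf-pairs (suc j) (λ xs σs → ind (rejects? g xs σs))) ⟨
        4 * #rejecting (suc j) g ∎
        where
        open ≤-Reasoning
        N : ℕ
        N = length (points n)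
        goal? : ∀ s v → Dec (¬ ((s ⊙ b) ⊕ vecSum (weighted g) v) ≡ b)
        goal? s v = ¬? (((s ⊙ b) ⊕ vecSum (weighted g) v) ≟V b)
        rej : V n → 𝕂 → Vec (V n × 𝕂) j → ℕ
        rej x s v = ind (rejects? g (x ∷ Vec.map proj₁ v) (s ∷ Vec.map proj₂ v))
        peel′ : ∀ {s} → s ∈ units → ∀ v → 3 * N * ind (goal? s v) ≤ 4 * ∑ (points n) (λ x → rej x s v)
        peel′ {s} s∈ v = subst (λ G → 3 * N * ind (¬? (((s ⊙ b) ⊕ G) ≟V b)) ≤ 4 * ∑ (points n) (λ x → rej x s v))
          (comb-pairs g v) (peel g b (∈-units⇒≢0 s∈) (comb g (Vec.map proj₂ v) (Vec.map proj₁ v)) (comb id (Vec.map proj₂ v) (Vec.map proj₁ v)) 8B<N)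

    0<#points : ∀ n → 0 < length (points n)
    0<#points n = ∈-length (∈-vecsOf ∈-allFin (𝟎 {n}))

    -- Low rejection forces constant differences, hence a nearby affine map.

    module _ {n r : ℕ} (f : V n → V r) where

      private
        N : ℕ
        N = length (points n)

      -- Two samples x and y remain random. All the others are fixed and contribute `c` to the query
      -- and `C` to the combination of answers.
      module _ {s t : 𝕂} (s≢0 : s ≢ fzero) (t≢0 : t ≢ fzero) (c : V n) (C : V r)
               (few : 16 * ∑ (points n) (λ x → ∑ (points n) (λ y →
                        ind (¬? (((s ⊙ f x) ⊕ ((t ⊙ f y) ⊕ C)) ≟V f ((s ⊙ x) ⊕ ((t ⊙ y) ⊕ c)))))) < N * N) where

        private
          acc? : ∀ x y → Dec _
          acc? x y = ((s ⊙ f x) ⊕ ((t ⊙ f y) ⊕ C)) ≟V f ((s ⊙ x) ⊕ ((t ⊙ y) ⊕ c))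

          rej : V n → V n → ℕ
          rej x y = ind (¬? (acc? x y))

          s⁻¹ : 𝕂
          s⁻¹ = proj₁ (inverse s s≢0)

          s⁻¹s : ∀ {m} (x : V m) → s⁻¹ ⊙ (s ⊙ x) ≡ x
          s⁻¹s = ⊙-inverse s s⁻¹ (proj₂ (inverse s s≢0))

        -- Compares the pairs (x + u, y) and (x, y), in the variables x and w = sx + ty + c.
        derivative : ∀ u → ∃ λ v → 8 * ∑ (points n) (λ x → ind (¬? (f (x ⊕ u) ≟V (v ⊕ f x)))) < N
        derivative u = finish (average 8 (points n) (λ w → ∑ (points n) (λ x → discrepant x w)) N few′)
          where
          agree? : ∀ x w → Dec _
          agree? x w = ((s ⊙ f (x ⊕ u)) ⊕ f w) ≟V (f (w ⊕ (s ⊙ u)) ⊕ (s ⊙ f x))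
          discrepant : V n → V n → ℕ
          discrepant x w = ind (¬? (agree? x w))
          shift : ∀ x y → (s ⊙ (x ⊕ u)) ⊕ ((t ⊙ y) ⊕ c) ≡ ((s ⊙ x) ⊕ ((t ⊙ y) ⊕ c)) ⊕ (s ⊙ u)
          shift x y = trans (cong (_⊕ ((t ⊙ y) ⊕ c)) (⊙-distrib-⊕ s x u))
            (⊕-swapʳ (s ⊙ x) (s ⊙ u) ((t ⊙ y) ⊕ c))
          -- The events counted are rejections, so their complements are double negations.
          agree : ∀ x y → ¬ ¬ (s ⊙ f (x ⊕ u)) ⊕ ((t ⊙ f y) ⊕ C) ≡ f ((s ⊙ (x ⊕ u)) ⊕ ((t ⊙ y) ⊕ c)) →
                  ¬ ¬ (s ⊙ f x) ⊕ ((t ⊙ f y) ⊕ C) ≡ f ((s ⊙ x) ⊕ ((t ⊙ y) ⊕ c)) →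
                  ¬ ¬ (s ⊙ f (x ⊕ u)) ⊕ f ((s ⊙ x) ⊕ ((t ⊙ y) ⊕ c)) ≡ f (((s ⊙ x) ⊕ ((t ⊙ y) ⊕ c)) ⊕ (s ⊙ u)) ⊕ (s ⊙ f x)
          agree x y a₁ a₂ ne = a₁ (λ e₁ → a₂ (λ e₂ → ne
            (trans (cong ((s ⊙ f (x ⊕ u)) ⊕_) (sym e₂))
            (trans (⊕-pullʳ (s ⊙ f (x ⊕ u)) (s ⊙ f x) ((t ⊙ f y) ⊕ C))
            (cong (_⊕ (s ⊙ f x)) (trans e₁ (cong f (shift x y))))))))
          few′ : 8 * ∑ (points n) (λ w → ∑ (points n) (λ x → discrepant x w)) < N * N
          few′ = begin-strict
            8 * ∑ (points n) (λ w → ∑ (points n) (λ x → discrepant x w))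
              ≡⟨ cong (8 *_) (∑-swap (points n) (points n) discrepant) ⟨
            8 * ∑ (points n) (λ x → ∑ (points n) (discrepant x))
              -- For fixed x the point w = sx + ty + c runs over the whole space with y, because t
              -- is nonzero.
              ≡⟨ cong (8 *_) (∑-cong (points n) (λ x →
                   trans (∑-dilate t≢0 (λ y → discrepant x ((s ⊙ x) ⊕ (y ⊕ c))))
                   (trans (∑-translateʳ c (λ y → discrepant x ((s ⊙ x) ⊕ y)))
                   (∑-translateˡ (s ⊙ x) (discrepant x))))) ⟨
            8 * ∑ (points n) (λ x → ∑ (points n) (λ y → discrepant x ((s ⊙ x) ⊕ ((t ⊙ y) ⊕ c))))
              ≤⟨ *-monoʳ-≤ 8 (∑-mono (points n) (λ x → ∑-mono (points n) (λ y →
                   ind-∪ (¬? (agree? x ((s ⊙ x) ⊕ ((t ⊙ y) ⊕ c)))) (¬? (acc? (x ⊕ u) y)) (¬? (acc? x y)) (agree x y)))) ⟩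
            8 * ∑ (points n) (λ x → ∑ (points n) (λ y → rej (x ⊕ u) y + rej x y))
              ≡⟨ cong (8 *_) (trans (∑-cong (points n) (λ x → ∑-+ (points n) (rej (x ⊕ u)) (rej x))) (∑-+ (points n) _ _)) ⟩
            8 * (∑ (points n) (λ x → ∑ (points n) (rej (x ⊕ u))) + S)
              ≡⟨ cong (λ a → 8 * (a + S)) (∑-translateʳ u (λ x → ∑ (points n) (rej x))) ⟩
            8 * (S + S)
              -- A discrepancy needs one of two rejections, each of frequency below 1/16; hence the
              -- bound 1/8.
              ≡⟨ eq S ⟩
            16 * S
              <⟨ few ⟩
            N * N ∎
            where
            open ≤-Reasoning
            S : ℕ
            S = ∑ (points n) (λ x → ∑ (points n) (rej x))
            eq : ∀ S → 8 * (S + S) ≡ 16 * S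
            eq = solve-∀
          solved : ∀ w x → (s ⊙ f (x ⊕ u)) ⊕ f w ≡ f (w ⊕ (s ⊙ u)) ⊕ (s ⊙ f x) →
                   f (x ⊕ u) ≡ (s⁻¹ ⊙ (f (w ⊕ (s ⊙ u)) ⊕ (⊖ f w))) ⊕ f x
          solved w x e = begin
            f (x ⊕ u)                         ≡⟨ s⁻¹s (f (x ⊕ u)) ⟨
            s⁻¹ ⊙ (s ⊙ f (x ⊕ u))             ≡⟨ cong (s⁻¹ ⊙_) (⊕-cancelʳ (f w) _ _ (begin
              (s ⊙ f (x ⊕ u)) ⊕ f w           ≡⟨ e ⟩
              f w′ ⊕ (s ⊙ f x)                ≡⟨ ⊕-identityʳ _ ⟨
              (f w′ ⊕ (s ⊙ f x)) ⊕ 𝟎          ≡⟨ cong ((f w′ ⊕ (s ⊙ f x)) ⊕_) (⊕-inverseˡ (f w)) ⟨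
              (f w′ ⊕ (s ⊙ f x)) ⊕ ((⊖ f w) ⊕ f w)
                ≡⟨ trans (⊕-interchange (f w′) (s ⊙ f x) (⊖ f w) (f w)) (sym (⊕-assoc (f w′ ⊕ (⊖ f w)) (s ⊙ f x) (f w))) ⟩
              ((f w′ ⊕ (⊖ f w)) ⊕ (s ⊙ f x)) ⊕ f w ∎)) ⟩
            s⁻¹ ⊙ ((f w′ ⊕ (⊖ f w)) ⊕ (s ⊙ f x)) ≡⟨ ⊙-distrib-⊕ s⁻¹ _ _ ⟩
            (s⁻¹ ⊙ (f w′ ⊕ (⊖ f w))) ⊕ (s⁻¹ ⊙ (s ⊙ f x)) ≡⟨ cong ((s⁻¹ ⊙ (f w′ ⊕ (⊖ f w))) ⊕_) (s⁻¹s (f x)) ⟩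
            (s⁻¹ ⊙ (f w′ ⊕ (⊖ f w))) ⊕ f x ∎
            where
            open ≡-Reasoning
            w′ : V n
            w′ = w ⊕ (s ⊙ u)

          finish : (∃ λ w → w ∈ points n × 8 * ∑ (points n) (λ x → discrepant x w) < N) →
                   ∃ λ v → 8 * ∑ (points n) (λ x → ind (¬? (f (x ⊕ u) ≟V (v ⊕ f x)))) < N
          finish (w , _ , lt) = v , ≤-<-trans
            (*-monoʳ-≤ 8 (∑-mono (points n) (λ x → ind-mono (¬? (f (x ⊕ u) ≟V (v ⊕ f x))) (¬? (agree? x w)) (λ ne e → ne (solved w x e))))) lt
            where
            v : V r
            -- Averaging has fixed one good w, so this candidate for f(x + u) - f(x) does not depend
            -- on x.
            v = s⁻¹ ⊙ (f (w ⊕ (s ⊙ u)) ⊕ (⊖ f w))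

      module _ (derive : ∀ u → ∃ λ v → 8 * ∑ (points n) (λ x → ind (¬? (f (x ⊕ u) ≟V (v ⊕ f x)))) < N) where

        private
          φ : V n → V r
          φ u = proj₁ (derive u)

          bad : V n → V n → ℕ
          bad u x = ind (¬? (f (x ⊕ u) ≟V (φ u ⊕ f x)))

          bad-few : ∀ u → 8 * ∑ (points n) (bad u) < N
          bad-few u = proj₂ (derive u)

        -- The equations for u + v at x, for u at x + v and for v at x each fail for less than 1/8
        -- of all x. Some x satisfies all three, and there the differences telescope.
        φ-hom : IsHom φ
        -- With the bound 8 on `8 * failures x`, the chosen x has no failure at all.
        φ-hom u v = finish (average 8 (points n) failures 8 few)
          where
          failures : V n → ℕ
          failures x = bad (u ⊕ v) x + (bad u (x ⊕ v) + bad v x)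
          few : 8 * ∑ (points n) failures < N * 8
          few = begin-strict
            8 * ∑ (points n) failures
              ≡⟨ cong (8 *_) (trans (∑-+ (points n) _ _) (cong (∑ (points n) (bad (u ⊕ v)) +_)
                   (trans (∑-+ (points n) _ _) (cong (_+ ∑ (points n) (bad v)) (∑-translateʳ v (bad u)))))) ⟩
            8 * (∑ (points n) (bad (u ⊕ v)) + (∑ (points n) (bad u) + ∑ (points n) (bad v)))
              ≡⟨ eq₁ (∑ (points n) (bad (u ⊕ v))) (∑ (points n) (bad u)) (∑ (points n) (bad v)) ⟩
            8 * ∑ (points n) (bad (u ⊕ v)) + (8 * ∑ (points n) (bad u) + 8 * ∑ (points n) (bad v))
              <⟨ +-mono-< (bad-few (u ⊕ v)) (+-mono-< (bad-few u) (bad-few v)) ⟩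
            N + (N + N)
              ≤⟨ m≤m+n _ (5 * N) ⟩
            N + (N + N) + 5 * N
              ≡⟨ eq₂ N ⟩
            N * 8 ∎
            where
            open ≤-Reasoning
            eq₁ : ∀ a b c → 8 * (a + (b + c)) ≡ 8 * a + (8 * b + 8 * c)
            eq₁ = solve-∀
            eq₂ : ∀ N → N + (N + N) + 5 * N ≡ N * 8
            eq₂ = solve-∀
          finish : (∃ λ x → x ∈ points n × 8 * failures x < 8) → φ (u ⊕ v) ≡ φ u ⊕ φ v
          finish (x , _ , lt) = ⊕-cancelʳ (f x) _ _ (begin
            φ (u ⊕ v) ⊕ f x     ≡⟨ ind¬≡0⇒ (f (x ⊕ (u ⊕ v)) ≟V (φ (u ⊕ v) ⊕ f x)) good₁ ⟨
            f (x ⊕ (u ⊕ v))     ≡⟨ cong f (trans (cong (x ⊕_) (⊕-comm u v)) (sym (⊕-assoc x v u))) ⟩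
            f ((x ⊕ v) ⊕ u)     ≡⟨ ind¬≡0⇒ (f ((x ⊕ v) ⊕ u) ≟V (φ u ⊕ f (x ⊕ v))) (m+n≡0⇒m≡0 (bad u (x ⊕ v)) good₂₃) ⟩
            φ u ⊕ f (x ⊕ v)     ≡⟨ cong (φ u ⊕_) (ind¬≡0⇒ (f (x ⊕ v) ≟V (φ v ⊕ f x)) (m+n≡0⇒n≡0 (bad u (x ⊕ v)) good₂₃)) ⟩
            φ u ⊕ (φ v ⊕ f x)   ≡⟨ ⊕-assoc (φ u) (φ v) (f x) ⟨
            (φ u ⊕ φ v) ⊕ f x   ∎)
            where
            open ≡-Reasoning
            none : failures x ≡ 0
            none = n<1⇒n≡0 (*-cancelˡ-< 8 (failures x) 1 lt)
            good₁ : bad (u ⊕ v) x ≡ 0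
            good₁ = m+n≡0⇒m≡0 (bad (u ⊕ v) x) none
            good₂₃ : bad u (x ⊕ v) + bad v x ≡ 0
            good₂₃ = m+n≡0⇒n≡0 (bad (u ⊕ v) x) none

        -- Averaging over x with u free gives a base point x₀ such that f(x₀ + u) = φ(u) + f(x₀) for
        -- most u. As φ is additive, the constant is f(x₀) - φ(x₀).
        affine : ∃ λ b → 8 * ∑ (points n) (λ x → ind (¬? (f x ≟V (φ x ⊕ b)))) < N
        affine = finish (average 8 (points n) (λ x → ∑ (points n) (λ u → bad u x)) N
          (subst (_< N * N) (trans (∑-* 8 (points n) _) (cong (8 *_) (∑-swap (points n) (points n) bad)))
            (∑-<-const (points n) (λ u → 8 * ∑ (points n) (bad u)) N (0<#points n) bad-few)))
          where
          finish : (∃ λ x → x ∈ points n × 8 * ∑ (points n) (λ u → bad u x) < N) →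
                   ∃ λ b → 8 * ∑ (points n) (λ x → ind (¬? (f x ≟V (φ x ⊕ b)))) < N
          finish (x₀ , _ , few) = b , ≤-<-trans (*-monoʳ-≤ 8 (≤-trans
            (≤-reflexive (sym (∑-translateˡ x₀ (λ x → ind (¬? (f x ≟V (φ x ⊕ b)))))))
            (∑-mono (points n) (λ u → ind-mono (¬? (f (x₀ ⊕ u) ≟V (φ (x₀ ⊕ u) ⊕ b))) (¬? (f (x₀ ⊕ u) ≟V (φ u ⊕ f x₀))) (λ ne e → ne (trans e (sym (shift u)))))))) few
            where
            b : V r
            b = f x₀ ⊕ (⊖ φ x₀)
            shift : ∀ u → φ (x₀ ⊕ u) ⊕ b ≡ φ u ⊕ f x₀
            shift u = trans (cong (_⊕ b) (φ-hom x₀ u))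
              (trans (cong (_⊕ b) (⊕-comm (φ x₀) (φ u))) (trans (⊕-interchange (φ u) (φ x₀) (f x₀) (⊖ φ x₀))
              (trans (cong ((φ u ⊕ f x₀) ⊕_) (⊕-inverseʳ (φ x₀))) (⊕-identityʳ _))))

        differences⇒nearlyAffine : ∃ λ (h : V n → V r) → IsHom h × ∃ λ b → 8 * ∑ (points n) (λ x → ind (¬? (f x ≟V (h x ⊕ b)))) < N
        differences⇒nearlyAffine = φ , φ-hom , affine

      -- Averaging successively fixes the first coefficient, the second, the remaining coefficients
      -- and the remaining points, each time keeping the conditional rejection probability below
      -- 1/16. Only two sample points stay random.
      nearlyAffine : ∀ m → 16 * #rejecting (suc (suc m)) f < length units ^ suc (suc m) * N ^ suc (suc m) →
        ∃ λ (h : V n → V r) → IsHom h × ∃ λ b → 8 * ∑ (points n) (λ x → ind (¬? (f x ≟V (h x ⊕ b)))) < N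
      nearlyAffine m few = fixed₁ (average 16 units _ (K * K ^ m * N ^ suc (suc m)) (subst₂ _<_ (cong (16 *_) (trans
          (∑-swap (vecsOf (points n) (suc (suc m))) (vecsOf units (suc (suc m))) _) (∑-vecsOf-suc units (suc m) _)))
          (*-assoc K (K * K ^ m) (N ^ suc (suc m))) few))
        where
        K : ℕ
        K = length units
        conclusion : Set
        conclusion = ∃ λ (h : V n → V r) → IsHom h × ∃ λ b → 8 * ∑ (points n) (λ x → ind (¬? (f x ≟V (h x ⊕ b)))) < N
        rejections : Vec 𝕂 (suc (suc m)) → ℕ
        rejections σs = ∑ (vecsOf (points n) (suc (suc m))) (λ xs → ind (rejects? f xs σs))
        fixed₄ : ∀ {s t} → s ∈ units → t ∈ units → ∀ σs →
          (∃ λ xs → xs ∈ vecsOf (points n) m × 16 * ∑ (points n) (λ x → ∑ (points n) (λ y → ind (rejects? f (x ∷ y ∷ xs) (s ∷ t ∷ σs)))) < N * N) → conclusion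
        fixed₄ s∈ t∈ σs (xs , _ , lt) = differences⇒nearlyAffine (derivative (∈-units⇒≢0 s∈) (∈-units⇒≢0 t∈) (comb id σs xs) (comb f σs xs) lt)
        fixed₃ : ∀ {s t} → s ∈ units → t ∈ units →
          (∃ λ σs → σs ∈ vecsOf units m × 16 * rejections (s ∷ t ∷ σs) < N ^ suc (suc m)) → conclusion
        fixed₃ {s} {t} s∈ t∈ (σs , _ , lt) = fixed₄ s∈ t∈ σs (average 16 (vecsOf (points n) m) _ (N * N)
          (subst₂ _<_ (cong (16 *_) reorder) (trans (eq N (N ^ m)) (cong (_* (N * N)) (sym (length-vecsOf (points n) m)))) lt))
          where
          eq : ∀ N M → N * (N * M) ≡ M * (N * N)
          eq = solve-∀
          reorder : rejections (s ∷ t ∷ σs) ≡ ∑ (vecsOf (points n) m) (λ xs → ∑ (points n) (λ x → ∑ (points n) (λ y →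
                      ind (rejects? f (x ∷ y ∷ xs) (s ∷ t ∷ σs)))))
          reorder = trans (∑-vecsOf-suc (points n) (suc m) _)
            (trans (∑-cong (points n) (λ x → trans (∑-vecsOf-suc (points n) m _) (∑-swap (points n) (vecsOf (points n) m) _)))
            (∑-swap (points n) (vecsOf (points n) m) _))
        fixed₂ : ∀ {s} → s ∈ units →
          (∃ λ t → t ∈ units × 16 * ∑ (vecsOf units m) (λ σs → rejections (s ∷ t ∷ σs)) < K ^ m * N ^ suc (suc m)) → conclusion
        fixed₂ {s} s∈ (t , t∈ , lt) = fixed₃ s∈ t∈ (average 16 (vecsOf units m) _ (N ^ suc (suc m))
          (subst (λ l → 16 * ∑ (vecsOf units m) (λ σs → rejections (s ∷ t ∷ σs)) < l * N ^ suc (suc m)) (sym (length-vecsOf units m)) lt))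
        fixed₁ : (∃ λ s → s ∈ units × 16 * ∑ (vecsOf units (suc m)) (λ σs → rejections (s ∷ σs)) < K * K ^ m * N ^ suc (suc m)) → conclusion
        fixed₁ (s , s∈ , lt) = fixed₂ s∈ (average 16 units _ (K ^ m * N ^ suc (suc m))
          (subst₂ _<_ (cong (16 *_) (∑-vecsOf-suc units m _)) (*-assoc K (K ^ m) (N ^ suc (suc m))) lt))

    -- Rejection for a nonzero constant term, and near the zero map.

    ⊙-cancelʳ : ∀ {r} (b : V r) → b ≢ 𝟎 → ∀ s t → s ⊙ b ≡ t ⊙ b → s ≡ t
    ⊙-cancelʳ [] b≢0 s t e = contradiction refl b≢0
    ⊙-cancelʳ (a ∷ b) b≢0 s t e with a ≟F fzero
    ... | no a≢0 = mulF-cancelʳ a a≢0 s t (cong Vec.head e)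
    ... | yes refl = ⊙-cancelʳ b (λ b≡0 → b≢0 (cong (fzero ∷_) b≡0)) s t (cong Vec.tail e)

    lookup-≢0 : ∀ {r} (b : V r) → b ≢ 𝟎 → ∃ λ i → lookup b i ≢ fzero
    lookup-≢0 [] b≢0 = contradiction refl b≢0
    lookup-≢0 (a ∷ b) b≢0 with a ≟F fzero
    ... | no a≢0 = fzero , a≢0
    ... | yes refl with lookup-≢0 b (λ b≡0 → b≢0 (cong (fzero ∷_) b≡0))
    ... | i , bᵢ≢0 = fsuc i , bᵢ≢0

    ⊙-≢0 : ∀ {r s} {y : V r} → s ≢ fzero → s ⊙ y ≡ 𝟎 → y ≡ 𝟎
    ⊙-≢0 {s = s} {y} s≢0 e = trans (sym (⊙-inverse s (proj₁ (inverse s s≢0)) (proj₂ (inverse s s≢0)) y))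
      (trans (cong (proj₁ (inverse s s≢0) ⊙_) e) (⊙-zeroʳ (proj₁ (inverse s s≢0))))

    ⊖-hom : ∀ {n r} {h : V n → V r} → IsHom h → IsHom (λ x → ⊖ h x)
    ⊖-hom {h = h} hom x y = trans (cong ⊖_ (hom x y)) (sym (⊖-⊕-comm (h x) (h y)))

    module _ {n r : ℕ} (g : V n → V r) where

      private
        N K M : ℕ
        N = length (points n)
        K = length units
        M = length (pairs {n})

        M≡NK : M ≡ N * K
        M≡NK = length-cartesianProduct (points n) units

      -- For fixed other samples, σ₁b + G = b has at most one solution σ₁ since b is nonzero. So at
      -- least K - 1 of the K coefficients are good, which is half of them or more once K is at
      -- least 2.
      #offsetSums-unitsLarge : 2 ≤ K → ∀ {b} → b ≢ 𝟎 → ∀ j → K * M ^ j ≤ 2 * #offsetSums g b j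
      #offsetSums-unitsLarge 2≤K {b} b≢0 j = begin
        K * M ^ j                                        ≡⟨ *-comm K (M ^ j) ⟩
        M ^ j * K                                        ≡⟨ cong (_* K) (length-vecsOf pairs j) ⟨
        length (vecsOf pairs j) * K                      ≡⟨ ∑-const (vecsOf pairs j) K ⟨
        ∑ (vecsOf pairs j) (λ _ → K)                     ≤⟨ ∑-mono (vecsOf pairs j) most ⟩
        ∑ (vecsOf pairs j) (λ v → 2 * ∑ units (λ s → ind (¬? (equal? v s)))) ≡⟨ ∑-* 2 (vecsOf pairs j) _ ⟩
        2 * ∑ (vecsOf pairs j) (λ v → ∑ units (λ s → ind (¬? (equal? v s)))) ≡⟨ cong (2 *_) (∑-swap (vecsOf pairs j) units _) ⟩
        2 * #offsetSums g b j                            ∎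
        where
        open ≤-Reasoning
        equal? : ∀ (v : Vec (V n × 𝕂) j) s → Dec (((s ⊙ b) ⊕ vecSum (weighted g) v) ≡ b)
        equal? v s = ((s ⊙ b) ⊕ vecSum (weighted g) v) ≟V b
        eq : ∀ D → D + 1 + (D + 1) ≡ 2 * D + 2
        eq = solve-∀
        most : ∀ v → K ≤ 2 * ∑ units (λ s → ind (¬? (equal? v s)))
        most v = +-cancelʳ-≤ 2 _ _ (begin
          K + 2          ≤⟨ +-monoʳ-≤ K 2≤K ⟩
          K + K          ≤⟨ +-mono-≤ K≤ K≤ ⟩
          D + 1 + (D + 1) ≡⟨ eq D ⟩
          2 * D + 2      ∎)
          where
          D : ℕ
          D = ∑ units (λ s → ind (¬? (equal? v s)))
          K≤ : K ≤ D + 1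
          K≤ = begin
            K            ≡⟨ ∑-complement units (λ s → ¬? (equal? v s)) (equal? v) (λ _ ne e → ne e) (λ s nne → decidable-stable (equal? v s) nne) ⟨
            D + ∑ units (λ s → ind (equal? v s)) ≤⟨ +-monoʳ-≤ D (∑-atMostOne (equal? v) units-Unique
                (λ {s} {t} _ _ e₁ e₂ → ⊙-cancelʳ b b≢0 s t (⊕-cancelʳ (vecSum (weighted g) v) _ _ (trans e₁ (sym e₂))))) ⟩
            D + 1        ∎

      -- Good offsets have probability at least 1/2 and are rejected with probability at least 3/4.
      -- The resulting 3/8 is rounded down to the threshold 1/16.
      #rejecting-offset : ∀ j {b} → 8 * ∑ (points n) (λ x → ind (¬? (g x ≟V b))) < N →
        K * M ^ j ≤ 2 * #offsetSums g b j → M ^ suc j ≤ 16 * #rejecting (suc j) g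
      #rejecting-offset j {b} few large = begin
        M * M ^ j                        ≡⟨ cong (_* M ^ j) M≡NK ⟩
        N * K * M ^ j                    ≡⟨ *-assoc N K (M ^ j) ⟩
        N * (K * M ^ j)                  ≤⟨ *-monoʳ-≤ N large ⟩
        N * (2 * D)                      ≤⟨ m≤m+n _ (4 * (N * D)) ⟩
        N * (2 * D) + 4 * (N * D)        ≡⟨ eq₁ N D ⟩
        2 * (3 * N * D)                  ≤⟨ *-monoʳ-≤ 2 (#rejecting-lower j g b few) ⟩
        2 * (4 * #rejecting (suc j) g)   ≤⟨ m≤m+n _ (8 * #rejecting (suc j) g) ⟩
        2 * (4 * #rejecting (suc j) g) + 8 * #rejecting (suc j) g ≡⟨ eq₂ (#rejecting (suc j) g) ⟩
        16 * #rejecting (suc j) g        ∎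
        where
        open ≤-Reasoning
        D : ℕ
        D = #offsetSums g b j
        eq₁ : ∀ N D → N * (2 * D) + 4 * (N * D) ≡ 2 * (3 * N * D)
        eq₁ = solve-∀
        eq₂ : ∀ R → 2 * (4 * R) + 8 * R ≡ 16 * R
        eq₂ = solve-∀

      -- Let β = jη with η = B/N. The bound on nonzero sums and the factor 3/4 give R/T ≥ (3/4)β/(1
      -- + 2β), which is `main`. Once 2β ≤ 1 is known, the right side is at least 3β/8.
      #rejecting-nearZero : ∀ j → let B = ∑ (points n) (λ x → ind (¬? (g x ≟V 𝟎))) in
        8 * B < N → 16 * #rejecting (suc j) g < M ^ suc j →
        j * B * M ^ suc j ≤ 3 * #rejecting (suc j) g * N
      #rejecting-nearZero j few R-small = *-cancelʳ-≤ _ _ K {{>-nonZero 0<K}} (*-cancelˡ-≤ 3 (begin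
        3 * (j * B * T * K)              ≡⟨ eq₁ j B T K ⟩
        3 * (j * (K * B) * T)            ≡⟨ cong (λ t → 3 * (j * t * T)) B′≡ ⟨
        3 * (j * B′ * T)                 ≤⟨ main ⟩
        4 * (R * (M + 2 * (j * B′)))     ≤⟨ *-monoʳ-≤ 4 (*-monoʳ-≤ R (+-monoʳ-≤ M small)) ⟩
        -- The additional `R * M` lowers the constant from 3/8 to 1/3.
        4 * (R * (M + M))                ≤⟨ m≤m+n _ (R * M) ⟩
        4 * (R * (M + M)) + R * M        ≡⟨ eq₂ R M ⟩
        3 * (3 * R * M)                  ≡⟨ cong (λ t → 3 * (3 * R * t)) M≡NK ⟩
        3 * (3 * R * (N * K))            ≡⟨ cong (3 *_) (*-assoc (3 * R) N K) ⟨
        3 * (3 * R * N * K)              ∎))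
        where
        open ≤-Reasoning
        B B′ R T P D : ℕ
        B = ∑ (points n) (λ x → ind (¬? (g x ≟V 𝟎)))
        B′ = #nonzero pairs (weighted g)
        R = #rejecting (suc j) g
        T = M ^ suc j
        P = #nonzeroSums pairs (weighted g) j
        D = #offsetSums g 𝟎 j
        eq₁ : ∀ j B T K → 3 * (j * B * T * K) ≡ 3 * (j * (K * B) * T)
        eq₁ = solve-∀
        eq₂ : ∀ R M → 4 * (R * (M + M)) + R * M ≡ 3 * (3 * R * M)
        eq₂ = solve-∀
        eq₃ : ∀ j B M Q → 3 * (j * B * (M * Q)) ≡ 3 * M * (j * B * Q)
        eq₃ = solve-∀
        eq₄ : ∀ N K P X → 3 * (N * K) * (P * X) ≡ 3 * N * (K * P) * X
        eq₄ = solve-∀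
        0<T : 0 < T
        0<T = ≤-<-trans z≤n R-small
        0<M : 0 < M
        0<M = n≢0⇒n>0 (λ M≡0 → <⇒≢ 0<T (sym (cong (_* M ^ j) M≡0)))
        0<K : 0 < K
        0<K = n≢0⇒n>0 (λ K≡0 → <⇒≢ 0<M (sym (trans M≡NK (trans (cong (N *_) K≡0) (*-zeroʳ N)))))
        -- Scaling by a nonzero coefficient preserves being nonzero, so points and pairs have the
        -- same proportion η.
        B′≡ : B′ ≡ K * B
        B′≡ = trans (∑-cartesianProduct (points n) units _)
          (trans (∑-cong (points n) (λ x → trans (∑-cong-∈ units (λ {s} s∈ → ≤-antisym
            (ind-mono (¬? ((s ⊙ g x) ≟V 𝟎)) (¬? (g x ≟V 𝟎)) (λ ne e → ne (trans (cong (s ⊙_) e) (⊙-zeroʳ s))))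
            (ind-mono (¬? (g x ≟V 𝟎)) (¬? ((s ⊙ g x) ≟V 𝟎)) (λ ne e → ne (⊙-≢0 (∈-units⇒≢0 s∈) e)))))
            (∑-const units _)))
          (∑-* K (points n) _))
        KP≤D : K * P ≤ D
        KP≤D = ≤-trans (≤-reflexive (sym (∑-const units P))) (∑-mono units (λ s → ∑-mono (vecsOf pairs j) (λ v →
          ind-mono (¬? (vecSum (weighted g) v ≟V 𝟎)) (¬? (((s ⊙ 𝟎) ⊕ vecSum (weighted g) v) ≟V 𝟎))
            (λ ne e → ne (trans (sym (trans (cong (_⊕ vecSum (weighted g) v) (⊙-zeroʳ s)) (⊕-identityˡ _))) e)))))
        2B′≤M : 2 * B′ ≤ M
        2B′≤M = begin
          2 * B′       ≡⟨ cong (2 *_) (trans B′≡ (*-comm K B)) ⟩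
          2 * (B * K)  ≡⟨ *-assoc 2 B K ⟨
          2 * B * K    ≤⟨ *-monoˡ-≤ K (≤-trans (*-monoˡ-≤ B {2} {8} (s≤s (s≤s z≤n))) (<⇒≤ few)) ⟩
          N * K        ≡⟨ M≡NK ⟨
          M            ∎
        main : 3 * (j * B′ * T) ≤ 4 * (R * (M + 2 * (j * B′)))
        main = begin
          3 * (j * B′ * T)                      ≡⟨ eq₃ j B′ M (M ^ j) ⟩
          3 * M * (j * B′ * M ^ j)              ≤⟨ *-monoʳ-≤ (3 * M) (#nonzeroSums-lower pairs (weighted g) 2B′≤M j) ⟩
          3 * M * (P * (M + 2 * (j * B′)))      ≡⟨ cong (λ t → 3 * t * (P * (M + 2 * (j * B′)))) M≡NK ⟩
          3 * (N * K) * (P * (M + 2 * (j * B′))) ≡⟨ eq₄ N K P (M + 2 * (j * B′)) ⟩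
          3 * N * (K * P) * (M + 2 * (j * B′))  ≤⟨ *-monoˡ-≤ (M + 2 * (j * B′)) (≤-trans (*-monoʳ-≤ (3 * N) KP≤D) (#rejecting-lower j g 𝟎 few)) ⟩
          4 * R * (M + 2 * (j * B′))            ≡⟨ *-assoc 4 R _ ⟩
          4 * (R * (M + 2 * (j * B′)))          ∎
        -- If 2β exceeded 1, then β/(1 + 2β) would be above 1/4 and `main` would push R/T above
        -- 3/16, against R/T < 1/16.
        small : 2 * (j * B′) ≤ M
        small = ≮⇒≥ (λ M<2jB′ → <-irrefl refl (begin-strict
          16 * R * (M + 2 * (j * B′))           <⟨ *-monoˡ-< (M + 2 * (j * B′)) {{>-nonZero (≤-trans 0<M (m≤m+n M _))}} R-small ⟩
          T * (M + 2 * (j * B′))                ≤⟨ *-monoʳ-≤ T (+-monoˡ-≤ (2 * (j * B′)) (<⇒≤ M<2jB′)) ⟩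
          T * (2 * (j * B′) + 2 * (j * B′))     ≤⟨ m≤m+n _ (8 * (j * B′ * T)) ⟩
          T * (2 * (j * B′) + 2 * (j * B′)) + 8 * (j * B′ * T) ≡⟨ eq₅ T (j * B′) ⟩
          4 * (3 * (j * B′ * T))                ≤⟨ *-monoʳ-≤ 4 main ⟩
          4 * (4 * (R * (M + 2 * (j * B′))))    ≡⟨ eq₆ R (M + 2 * (j * B′)) ⟩
          16 * R * (M + 2 * (j * B′))           ∎))
          where
          eq₅ : ∀ T X → T * (2 * X + 2 * X) + 8 * (X * T) ≡ 4 * (3 * (X * T))
          eq₅ = solve-∀
          eq₆ : ∀ R X → 4 * (4 * (R * X)) ≡ 16 * R * X
          eq₆ = solve-∀

  -- The field with two elements.

  module CharTwo (2-prime : Prime 2) where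
    open PrimeField 1 2-prime

    one-⊙ : ∀ {r} (y : V r) → fsuc fzero ⊙ y ≡ y
    one-⊙ y = trans (map-cong one-mulF y) (map-id y)
      where
      one-mulF : ∀ (c : 𝕂) → mulF (fsuc fzero) c ≡ c
      one-mulF fzero = refl
      one-mulF (fsuc fzero) = refl

    -- The only coefficient is 1, so the offset condition says that G is nonzero. At a coordinate
    -- where b is nonzero, a zero bit of `g` means deviation from b and is rare; G sums an odd
    -- number of such bits, so `half` applies.
    #offsetSums-odd : ∀ {n r} (g : V n → V r) {b} → b ≢ 𝟎 →
      8 * ∑ (points n) (λ x → ind (¬? (g x ≟V b))) < length (points n) →
      ∀ k → length units * length (pairs {n}) ^ suc (k * 2) ≤ 2 * #offsetSums g b (suc (k * 2))
    #offsetSums-odd {n} {r} g {b} b≢0 few k = begin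
      1 * M ^ suc (k * 2)                   ≡⟨ *-identityˡ _ ⟩
      M ^ suc (k * 2)                       ≤⟨ half #χ₀≤#χ₁ k ⟩
      2 * #odd (suc (k * 2))                ≤⟨ *-monoʳ-≤ 2 (∑-mono (vecsOf pairs (suc (k * 2))) (λ v →
          ind-mono (¬? (zero? (paritySum v))) (¬? (((fsuc fzero ⊙ b) ⊕ vecSum (weighted g) v) ≟V b)) (nonzeroSum v))) ⟩
      2 * ∑ (vecsOf pairs (suc (k * 2))) (λ v → ind (¬? (((fsuc fzero ⊙ b) ⊕ vecSum (weighted g) v) ≟V b)))
                                            ≡⟨ cong (2 *_) (∑-singleton (fsuc fzero) _) ⟨
      2 * #offsetSums g b (suc (k * 2))     ∎
      where
      open ≤-Reasoning
      i : Fin r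
      i = proj₁ (lookup-≢0 b b≢0)
      bᵢ≢0 : lookup b i ≢ fzero
      bᵢ≢0 = proj₂ (lookup-≢0 b b≢0)
      open Parity (pairs {n}) (λ a → lookup (weighted g a) i)
      N M B : ℕ
      N = length (points n)
      M = length (pairs {n})
      B = ∑ (points n) (λ x → ind (¬? (g x ≟V b)))
      paritySum≡ : ∀ {j} (v : Vec (V n × 𝕂) j) → lookup (vecSum (weighted g) v) i ≡ paritySum v
      paritySum≡ [] = lookup-replicate i fzero
      paritySum≡ (a ∷ v) = trans (lookup-zipWith addF i (weighted g a) (vecSum (weighted g) v))
        (cong (addF (lookup (weighted g a) i)) (paritySum≡ v))
      nonzeroSum : ∀ {j} (v : Vec (V n × 𝕂) j) → paritySum v ≢ fzero → (fsuc fzero ⊙ b) ⊕ vecSum (weighted g) v ≢ b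
      nonzeroSum v odd e = odd (trans (sym (paritySum≡ v)) (trans (cong (λ y → lookup y i) sum≡0) (lookup-replicate i fzero)))
        where
        sum≡0 : vecSum (weighted g) v ≡ 𝟎
        sum≡0 = ⊕-cancelˡ b _ _ (trans (cong (_⊕ vecSum (weighted g) v) (sym (one-⊙ b))) (trans e (sym (⊕-identityʳ b))))
      #χ₀≤B : #χ₀ ≤ B
      #χ₀≤B = ≤-trans (≤-reflexive (∑-cartesianProduct (points n) units _)) (∑-mono (points n) (λ x →
        ≤-trans (≤-reflexive (∑-singleton (fsuc fzero) _))
          (ind-mono (zero? (lookup (fsuc fzero ⊙ g x) i)) (¬? (g x ≟V b))
            (λ e gx≡b → bᵢ≢0 (trans (cong (λ y → lookup y i) (sym (trans (one-⊙ (g x)) gx≡b))) e)))))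
      #χ₀≤#χ₁ : #χ₀ ≤ #χ₁
      #χ₀≤#χ₁ = +-cancelˡ-≤ #χ₀ _ _ (begin
        #χ₀ + #χ₀     ≤⟨ +-mono-≤ #χ₀≤B #χ₀≤B ⟩
        B + B         ≤⟨ m≤m+n _ (6 * B) ⟩
        B + B + 6 * B ≡⟨ eq B ⟩
        8 * B         ≤⟨ <⇒≤ few ⟩
        N             ≡⟨ *-identityʳ N ⟨
        N * 1         ≡⟨ length-cartesianProduct (points n) units ⟨
        M             ≡⟨ ∑-complement pairs (λ a → zero? (lookup (weighted g a) i)) (λ a → ¬? (zero? (lookup (weighted g a) i)))
                           (λ _ e ne → ne e) (λ _ ne → ne) ⟨
        #χ₀ + #χ₁     ∎)
        where
        eq : ∀ B → B + B + 6 * B ≡ 8 * B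
        eq = solve-∀

  -- For p = 2 there is a single nonzero coefficient and counting coefficients gives nothing, so
  -- parity is used instead. Every larger prime offers at least two coefficients.
  #offsetSums-large : ∀ q (p-prime : Prime (suc q)) → let open PrimeField q p-prime in
    ∀ {n r} (g : V n → V r) {b} → b ≢ 𝟎 →
    8 * ∑ (points n) (λ x → ind (¬? (g x ≟V b))) < length (points n) →
    ∀ k → length units * length (pairs {n}) ^ suc (k * 2) ≤ 2 * #offsetSums g b (suc (k * 2))
  #offsetSums-large zero p-prime = contradiction p-prime ¬prime[1]
  #offsetSums-large (suc zero) p-prime = CharTwo.#offsetSums-odd p-prime
  #offsetSums-large (suc (suc q)) p-prime g b≢0 _ k =
    PrimeField.#offsetSums-unitsLarge (suc (suc q)) p-prime g (s≤s (s≤s z≤n)) b≢0 (suc (k * 2))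

  -- The soundness bound in natural numbers.

  module Soundness (q : ℕ) (p-prime : Prime (suc q)) where
    open PrimeField q p-prime

    -- With denominators restored the conclusion reads (m - 1)η/3 ≤ R/T, where η is the distance
    -- from f to h. The index is shifted: m = 2k + 2.
    soundness : ∀ {n r} (f : V n → V r) k →
      let m = suc (suc (k * 2)); N = length (points n); T = N ^ m * length units ^ m in
      16 * #rejecting m f < T →
      ∃ λ (h : V n → V r) → IsHom h ×
        suc (k * 2) * ∑ (points n) (λ x → ind (¬? (f x ≟V h x))) * T ≤ 3 * #rejecting m f * N
    soundness {n} {r} f k few = finish (nearlyAffine f (k * 2) (subst (16 * R <_) (*-comm (N ^ m) (K ^ m)) few))
      where
      m N K R T : ℕ
      m = suc (suc (k * 2))
      N = length (points n)
      K = length units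
      R = #rejecting m f
      T = N ^ m * K ^ m
      T≡ : length (pairs {n}) ^ m ≡ T
      T≡ = trans (cong (_^ m) (length-cartesianProduct (points n) units)) (^-distribˡ-* N K m)
      finish : (∃ λ (h : V n → V r) → IsHom h × ∃ λ b → 8 * ∑ (points n) (λ x → ind (¬? (f x ≟V (h x ⊕ b)))) < N) →
        ∃ λ (h : V n → V r) → IsHom h × suc (k * 2) * ∑ (points n) (λ x → ind (¬? (f x ≟V h x))) * T ≤ 3 * R * N
      finish (h , h-hom , b , near) = h , h-hom , conclude (b ≟V 𝟎)
        where
        g : V n → V r
        g x = f x ⊕ (⊖ h x)
        Rg≤R : #rejecting m g ≤ R
        Rg≤R = #rejecting-⊕-hom m (⊖-hom h-hom)
        f≡h⊕g : ∀ x → f x ≡ h x ⊕ g x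
        f≡h⊕g x = sym (trans (cong (h x ⊕_) (⊕-comm (f x) (⊖ h x))) (⊕-⊖-cancelˡ (h x) (f x)))
        near-g : ∀ c → (∀ x → f x ≡ h x ⊕ c → g x ≡ c)
        near-g c x e = ⊕-cancelˡ (h x) _ _ (trans (sym (f≡h⊕g x)) e)
        near′ : 8 * ∑ (points n) (λ x → ind (¬? (g x ≟V b))) < N
        near′ = ≤-<-trans (*-monoʳ-≤ 8 (∑-mono (points n) (λ x →
          ind-mono (¬? (g x ≟V b)) (¬? (f x ≟V (h x ⊕ b))) (λ ne e → ne (near-g b x e))))) near
        small : 16 * #rejecting m g < length (pairs {n}) ^ m
        small = ≤-<-trans (*-monoʳ-≤ 16 Rg≤R) (subst (16 * R <_) (sym T≡) few)
        open ≤-Reasoning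
        conclude : Dec (b ≡ 𝟎) → suc (k * 2) * ∑ (points n) (λ x → ind (¬? (f x ≟V h x))) * T ≤ 3 * R * N
        -- A nonzero constant term would already force rejection probability at least 1/16.
        conclude (no b≢0) = contradiction
          (#rejecting-offset g (suc (k * 2)) near′ (#offsetSums-large q p-prime g b≢0 near′ k)) (<⇒≱ small)
        conclude (yes b≡0) = begin
          suc (k * 2) * ∑ (points n) (λ x → ind (¬? (f x ≟V h x))) * T
            ≤⟨ *-monoˡ-≤ T (*-monoʳ-≤ (suc (k * 2)) (∑-mono (points n) (λ x →
                 ind-mono (¬? (f x ≟V h x)) (¬? (g x ≟V 𝟎)) (λ ne e → ne (trans (f≡h⊕g x) (trans (cong (h x ⊕_) e) (⊕-identityʳ (h x)))))))) ⟩
          suc (k * 2) * ∑ (points n) (λ x → ind (¬? (g x ≟V 𝟎))) * T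
            ≡⟨ cong (suc (k * 2) * ∑ (points n) (λ x → ind (¬? (g x ≟V 𝟎))) *_) T≡ ⟨
          suc (k * 2) * ∑ (points n) (λ x → ind (¬? (g x ≟V 𝟎))) * length (pairs {n}) ^ m
            ≤⟨ #rejecting-nearZero g (suc (k * 2))
                 (subst (λ b → 8 * ∑ (points n) (λ x → ind (¬? (g x ≟V b))) < N) b≡0 near′) small ⟩
          3 * #rejecting m g * N
            ≤⟨ *-monoˡ-≤ N (*-monoʳ-≤ 3 Rg≤R) ⟩
          3 * R * N ∎

-- From counts to rational probabilities.

open Counting

open import Data.Integer using (+_; +≤+) renaming (_-_ to _-ℤ_; _*_ to _*ℤ_; _≤_ to _≤ℤ_)
import Data.Integer.Properties as ℤ
open import Data.Nat using (_^_; _≤?_; >-nonZero; s≤s; z≤n) renaming (_<_ to _<ℕ_; _≤_ to _≤ℕ_)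
import Data.Nat.Properties as ℕ
open import Data.Rational using (ℚ; 0ℚ; 1ℚ; _/_; _<_; _≤_; _⊓_; toℚᵘ; nonNegative) renaming (_*_ to _*ℚ_)
import Data.Rational.Properties as ℚ
open import Data.Rational.Unnormalised as ℚᵘ using (mkℚᵘ)
import Data.Rational.Unnormalised.Properties as ℚᵘ

toℚᵘ-/ : ∀ a b → toℚᵘ (a / suc b) ℚᵘ.≃ mkℚᵘ a b
toℚᵘ-/ a b = ℚ.toℚᵘ-fromℚᵘ (mkℚᵘ a b)

-- Since `_/_` reduces to lowest terms, the comparison is made on unnormalised rationals, where the
-- order is cross-multiplication.
/-mono-≤ : ∀ {a c b d} → a *ℤ + suc d ≤ℤ c *ℤ + suc b → a / suc b ≤ c / suc d
/-mono-≤ {a} {c} {b} {d} le = ℚ.toℚᵘ-cancel-≤ (begin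
  toℚᵘ (a / suc b)  ≃⟨ toℚᵘ-/ a b ⟩
  mkℚᵘ a b          ≤⟨ ℚᵘ.*≤* le ⟩
  mkℚᵘ c d          ≃⟨ toℚᵘ-/ c d ⟨
  toℚᵘ (c / suc d)  ∎)
  where open ℚᵘ.≤-Reasoning

/-*-≤ : ∀ {a c e b d g} → a *ℤ c *ℤ + suc g ≤ℤ e *ℤ (+ suc b *ℤ + suc d) → (a / suc b) *ℚ (c / suc d) ≤ e / suc g
/-*-≤ {a} {c} {e} {b} {d} {g} le = ℚ.toℚᵘ-cancel-≤ (begin
  toℚᵘ ((a / suc b) *ℚ (c / suc d))            ≃⟨ ℚ.toℚᵘ-homo-* (a / suc b) (c / suc d) ⟩
  toℚᵘ (a / suc b) ℚᵘ.* toℚᵘ (c / suc d)       ≃⟨ ℚᵘ.*-cong (toℚᵘ-/ a b) (toℚᵘ-/ c d) ⟩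
  mkℚᵘ a b ℚᵘ.* mkℚᵘ c d                       ≤⟨ ℚᵘ.*≤* le ⟩
  mkℚᵘ e g                                     ≃⟨ toℚᵘ-/ e g ⟨
  toℚᵘ (e / suc g)                             ∎)
  where open ℚᵘ.≤-Reasoning

0≤frac : ∀ a b → 0ℚ ≤ frac a b
0≤frac a zero = ℚ.≤-refl
0≤frac a (suc b) = /-mono-≤ {+ 0} {+ a} {0} {b} (ℤ.≤-trans (ℤ.≤-reflexive (ℤ.*-zeroˡ (+ suc b))) (subst (+ 0 ≤ℤ_) (ℤ.pos-* a 1) (+≤+ z≤n)))

1/16≤frac : ∀ {a b} → 0 <ℕ b → b ≤ℕ 16 * a → (+ 1) / 16 ≤ frac a b
1/16≤frac {a} {suc b} _ le = /-mono-≤ {+ 1} {+ a} {15} {b}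
  (subst₂ _≤ℤ_ (sym (ℤ.*-identityˡ (+ suc b))) (ℤ.pos-* a 16) (+≤+ (subst (suc b ≤ℕ_) (ℕ.*-comm 16 a) le)))

frac-*-≤ : ∀ j {a b c d} → 0 <ℕ b → 0 <ℕ d → j * a * d ≤ℕ 3 * c * b → ((+ j) / 3) *ℚ frac a b ≤ frac c d
frac-*-≤ j {a} {suc b} {c} {suc d} _ _ le = /-*-≤ {+ j} {+ a} {+ c} {2} {b} {d} (subst₂ _≤ℤ_
  (trans (ℤ.pos-* (j * a) (suc d)) (cong (_*ℤ + suc d) (ℤ.pos-* j a)))
  (trans (ℤ.pos-* c (3 * suc b)) (cong (+ c *ℤ_) (ℤ.pos-* 3 (suc b))))
  (+≤+ (subst (j * a * suc d ≤ℕ_) (eq c (suc b)) le)))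
  where
  eq : ∀ c b → 3 * c * b ≡ c * (3 * b)
  eq = solve-∀

-- The case k = 0: the coefficient is -1, so the minimum is at most 0 and any probability exceeds or
-- equals it.
nonPositiveCoefficient : ∀ {ε x} → 0ℚ < ε → 0ℚ ≤ x → (((+ (2 * 0) -ℤ + 3) / 3) *ℚ ε) ⊓ ((+ 1) / 16) ≤ x
nonPositiveCoefficient {ε} {x} 0<ε 0≤x = begin
  (c *ℚ ε) ⊓ ((+ 1) / 16)  ≤⟨ ℚ.p⊓q≤p (c *ℚ ε) ((+ 1) / 16) ⟩
  c *ℚ ε                   ≤⟨ ℚ.*-monoˡ-≤-nonPos c (ℚ.<⇒≤ 0<ε) ⟩
  c *ℚ 0ℚ                  ≡⟨ ℚ.*-zeroʳ c ⟩
  0ℚ                       ≤⟨ 0≤x ⟩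
  x                        ∎
  where
  open ℚ.≤-Reasoning
  c : ℚ
  c = (+ (2 * 0) -ℤ + 3) / 3

module _ (q : ℕ) (p-prime : Prime (suc q)) where
  open PrimeField q p-prime

  -- Makes the number of samples positive, so that the default value of `frac` at denominator zero
  -- does not arise.
  0<#units : 0 <ℕ length units
  0<#units = positive q p-prime
    where
    positive : ∀ q → Prime (suc q) → 0 <ℕ length (nonzero (suc q))
    positive zero 1-prime = contradiction 1-prime ¬prime[1]
    positive (suc q) _ = s≤s z≤n

  dist≡ : ∀ {n r} (f h : V n → V r) →
          dist f h ≡ frac (∑ (points n) (λ x → ind (¬? (f x ≟V h x)))) (length (points n))
  dist≡ {n} f h = cong (λ a → frac a (length (points n))) (length-filter-∑ (λ x → ¬? (f x ≟V h x)) (points n))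

  rejProb≡ : ∀ {n r} m (f : V n → V r) →
             rejProb m f ≡ frac (#rejecting m f) (length (points n) ^ m * length units ^ m)
  rejProb≡ {n} m f = cong₂ frac
    (trans (length-filter-∑ (λ s → rejects? f (proj₁ s) (proj₂ s)) (samples (suc q) n m)) (∑-cartesianProduct (vecsOf (points n) m) (vecsOf units m) _))
    (trans (length-cartesianProduct (vecsOf (points n) m) (vecsOf units m))
      (cong₂ _*_ (length-vecsOf (points n) m) (length-vecsOf units m)))

  0≤rejProb : ∀ {n r} m (f : V n → V r) → 0ℚ ≤ rejProb m f
  0≤rejProb {n} m f = subst (0ℚ ≤_) (sym (rejProb≡ m f))
    (0≤frac (#rejecting m f) (length (points n) ^ m * length units ^ m))

  evenTest : ∀ k {ε} → 0ℚ < ε → ∀ {n r} (f : V n → V r) → Far ε f →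
    (((+ (suc k * 2) -ℤ + 3) / 3) *ℚ ε) ⊓ ((+ 1) / 16) ≤ rejProb (suc k * 2) f
  evenTest k {ε} 0<ε {n} {r} f far = subst ((c *ℚ ε) ⊓ ((+ 1) / 16) ≤_) (sym (rejProb≡ m f)) (bound (T ≤? 16 * R))
    where
    m N R T : ℕ
    m = suc k * 2
    N = length (points n)
    R = #rejecting m f
    T = N ^ m * length units ^ m
    c c′ : ℚ
    c = (+ m -ℤ + 3) / 3
    c′ = (+ suc (k * 2)) / 3
    0<T : 0 <ℕ T
    0<T = ℕ.*-mono-≤ (ℕ.m^n>0 N {{>-nonZero (0<#points n)}} m) (ℕ.m^n>0 (length units) {{>-nonZero 0<#units}} m)
    -- The argument yields the coefficient (m - 1)/3, which is lowered here to (m - 3)/3.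
    c≤c′ : c ≤ c′
    c≤c′ = /-mono-≤ {+ m -ℤ + 3} {+ suc (k * 2)} {2} {2}
      (ℤ.*-monoʳ-≤-nonNeg (+ 3) {+ m -ℤ + 3} {+ suc (k * 2)} (ℤ.+-monoʳ-≤ (+ m) (ℤ.neg-mono-≤ {+ 1} {+ 3} (+≤+ (s≤s z≤n)))))
    open ℚ.≤-Reasoning
    bound : Dec (T ≤ℕ 16 * R) → (c *ℚ ε) ⊓ ((+ 1) / 16) ≤ frac R T
    bound (yes large) = ℚ.≤-trans (ℚ.p⊓q≤q (c *ℚ ε) ((+ 1) / 16)) (1/16≤frac 0<T large)
    bound (no small) = nearHom (Soundness.soundness q p-prime f k (ℕ.≰⇒> small))
      where
      nearHom : (∃ λ (h : V n → V r) → IsHom h ×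
        suc (k * 2) * ∑ (points n) (λ x → ind (¬? (f x ≟V h x))) * T ≤ℕ 3 * R * N) → (c *ℚ ε) ⊓ ((+ 1) / 16) ≤ frac R T
      nearHom (h , h-hom , le) = begin
        (c *ℚ ε) ⊓ ((+ 1) / 16)   ≤⟨ ℚ.p⊓q≤p (c *ℚ ε) ((+ 1) / 16) ⟩
        c *ℚ ε                    ≤⟨ ℚ.*-monoʳ-≤-nonNeg ε {{nonNegative (ℚ.<⇒≤ 0<ε)}} c≤c′ ⟩
        -- Farness is applied to the homomorphism that soundness constructs.
        c′ *ℚ ε                   ≤⟨ ℚ.*-monoˡ-≤-nonNeg c′ {{nonNegative (0≤frac (suc (k * 2)) 3)}} (ℚ.<⇒≤ (far h h-hom)) ⟩
        c′ *ℚ dist f h            ≡⟨ cong (c′ *ℚ_) (dist≡ f h) ⟩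
        c′ *ℚ frac (∑ (points n) (λ x → ind (¬? (f x ≟V h x)))) N ≤⟨ frac-*-≤ (suc (k * 2)) (0<#points n) 0<T le ⟩
        frac R T                  ∎

theorem6p6 : ∀ (k : ℕ) (ε : ℚ) → 0ℚ < ε → ε < 1ℚ →
    ∀ (p : ℕ) → Prime p → ∀ (n r : ℕ) (f : 𝔽^ p n → 𝔽^ p r) → Far ε f →
    (((+ (2 * k) -ℤ + 3) / 3) *ℚ ε) ⊓ ((+ 1) / 16) ≤ rejProb (2 * k) f
theorem6p6 k ε 0<ε ε<1 zero p-prime n r f far = contradiction p-prime ¬prime[0]
theorem6p6 zero ε 0<ε ε<1 (suc q) p-prime n r f far =
  nonPositiveCoefficient 0<ε (0≤rejProb q p-prime 0 f)
theorem6p6 (suc k) ε 0<ε ε<1 (suc q) p-prime n r f far =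
  -- The product `suc k * 2` computes to `suc (suc (k * 2))`, which exposes the first two samples;
  -- the statement has `2 * suc k`.
  subst (λ m → (((+ m -ℤ + 3) / 3) *ℚ ε) ⊓ ((+ 1) / 16) ≤ rejProb m f) (ℕ.*-comm (suc k) 2)
    (evenTest q p-prime k 0<ε f far)
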